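{- Let $m\geqslant4$ be an integer. Then there are no strongly regular graphs with parameters $(v,k,\lambda,\mu)$ given by $$\mu=(m-3)^3+10(m-3)^2+33(m-3)+38,$$ $$\lambda=\frac{(m-3)^5+15(m-3)^4+91(m-3)^3+283(m-3)^2}{2}+226(m-3)+148,$$ $$k=\frac{(m+1)\bigl(m(2-\mu)+2\lambda\bigr)}{2}+1,$$ $$v=1+k+\frac{k(k-\lambda-1)}{\mu}.$$
   Context: All graphs are finite, undirected and simple. A regular graph with $v$ vertices and valency $k$ is edge-regular with parameters $(v,k,\lambda)$ if any two adjacent vertices have exactly $\lambda$ common neighbors. It is amply regular with parameters $(v,k,\lambda,\mu)$ if moreover any two vertices at distance $2$ have exactly $\mu$ common neighbors. A strongly regular graph with parameters $(v,k,\lambda,\mu)$ is an amply regular graph with parameters $(v,k,\lambda,\mu)$ of diameter at most $2$ (in particular it is connected). -}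

module Defs where

open import Data.Fin.Base using (Fin)
open import Data.Fin.Subset using (Subset; _∩_; ∣_∣)
open import Data.Integer.Base as ℤ using (+_)
open import Data.Nat.Base using (ℕ; suc; _+_; _*_; _∸_; _^_; _≤_; NonZero)
open import Data.Product.Base using (_×_; ∃)
open import Data.Rational.Unnormalised.Base as ℚᵘ using (_/_; _≃_; 1ℚᵘ)
open import Data.Vec.Base using (tabulate)
open import Level using (0ℓ)
open import Relation.Binary.Core using (Rel)
open import Relation.Binary.Definitions using (Decidable; Symmetric)
open import Relation.Binary.PropositionalEquality using (_≡_)
open import Relation.Nullary using (¬_; does)

record Graph (v : ℕ) : Set₁ where
  field
    Adj        : Rel (Fin v) 0ℓ
    adj?       : Decidable Adj
    adj-sym    : Symmetric Adj
    adj-irrefl : ∀ x → ¬ Adj x x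

  neighbours : Fin v → Subset v
  neighbours x = tabulate (λ y → does (adj? x y))

  data Walk : Fin v → Fin v → ℕ → Set where
    []  : ∀ {x} → Walk x x 0
    _∷_ : ∀ {x y z n} → Adj x y → Walk y z n → Walk x z (suc n)

  Distance : Fin v → Fin v → ℕ → Set
  Distance x y d = Walk x y d × (∀ n → Walk x y n → d ≤ n)

  -- A distance is required to exist for every pair, so this includes connectedness.
  Diameter≤ : ℕ → Set
  Diameter≤ D = ∀ x y → ∃ λ d → Distance x y d × d ≤ D

-- In the following records the first parameter v of (v , k , lam , μ) is the
-- index of G, and lam stands for the (reserved) symbol λ.

record EdgeRegular {v : ℕ} (G : Graph v) (k lam : ℕ) : Set where
  open Graph G
  field
    valency         : ∀ x → ∣ neighbours x ∣ ≡ k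
    common-adjacent : ∀ x y → Adj x y → ∣ neighbours x ∩ neighbours y ∣ ≡ lam

record AmplyRegular {v : ℕ} (G : Graph v) (k lam μ : ℕ) : Set where
  open Graph G
  field
    edgeRegular      : EdgeRegular G k lam
    common-distance2 : ∀ x y → Distance x y 2 → ∣ neighbours x ∩ neighbours y ∣ ≡ μ

record StronglyRegular {v : ℕ} (G : Graph v) (k lam μ : ℕ) : Set where
  open Graph G
  field
    amplyRegular : AmplyRegular G k lam μ
    diameter     : Diameter≤ 2

-- The fractions are exact rational ones: no integrality is presupposed and
-- nothing is rounded.  The truncated subtraction m ∸ 3 is the true difference
-- m - 3 in the intended range m ≥ 4; all other differences are taken in ℤ.
-- NonZero μ only makes the division by μ well-formed: it is never a restriction,
-- because μ-formula forces μ ≥ 38.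
record Parameters (m v k lam μ : ℕ) : Set where
  t : ℕ
  t = m ∸ 3

  field
    μ-formula : μ ≡ t ^ 3 + 10 * t ^ 2 + 33 * t + 38
    λ-formula : + lam / 1 ≃
                (+ (t ^ 5 + 15 * t ^ 4 + 91 * t ^ 3 + 283 * t ^ 2)) / 2
                  ℚᵘ.+ (+ (226 * t + 148)) / 1
    k-formula : + k / 1 ≃
                (+ (m + 1) ℤ.* (+ m ℤ.* (+ 2 ℤ.- + μ) ℤ.+ + 2 ℤ.* + lam)) / 2
                  ℚᵘ.+ 1ℚᵘ
    v-formula : .{{_ : NonZero μ}} →
                + v / 1 ≃
                1ℚᵘ ℚᵘ.+ + k / 1
                  ℚᵘ.+ (+ k ℤ.* (+ k ℤ.- + lam ℤ.- + 1)) / μ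

{-# OPTIONS --safe #-}
module Submission where

-- Put L = μ - 1, let Δ be the neighbourhood of a vertex x, and let nb y be the
-- closed neighbourhood of y in Δ.  It has λ + 1 elements, and nb y and nb z
-- share at most L if y and z are nonadjacent.  Inclusion-exclusion bounds a
-- coclique of Δ by m + 1 vertices.  For a maximum coclique y₀, …, yₙ, the part
-- Pᵢ of nb yᵢ private to yᵢ is a clique; an exchange argument shows that every
-- vertex of Δ is adjacent to all of some Pᵢ, and the vertices adjacent to all
-- of a Pᵢ form with x a clique, a "line" on x.  Two lines, one on x and one on a
-- nonadjacent z, are so large that they share at most one vertex, so
-- μ ≤ (m + 1)², whereas μ = m³ + m² + 2.  Everything needs (2n + 1) L < λ + 1,
-- which fails only for m = n = 4; then a finer count leaves 6 exceptional
-- vertices in Δ, and 25 + 12 < 82 = μ still suffices.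

open import Defs
open import Data.Bool using (Bool; true; false; T; _∧_; _∨_; not; if_then_else_)
open import Data.Bool.Properties as Bool using (∧-conicalˡ; ∧-conicalʳ; ∨-conicalˡ; ∨-conicalʳ; ∧-zeroʳ)
open import Data.Empty using (⊥; ⊥-elim)
open import Data.Fin.Base using (Fin; zero; suc; punchIn; punchOut)
open import Data.Fin.Properties using (_≟_; all?; any?; ¬∀⟶∃¬; punchIn-punchOut; punchInᵢ≢i; punchIn-injective; suc-injective)
open import Data.Fin.Subset using (∣_∣; _∩_)
open import Data.Integer.Base as ℤ using () renaming (+_ to pos)
import Data.Integer.Properties as ℤ
import Data.Integer.Tactic.RingSolver as ℤSolver
open import Data.List.Base using (List; []; _∷_; allFin)
open import Data.List.Membership.Propositional using (_∈_)
open import Data.List.Membership.Propositional.Properties using (∈-allFin)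
open import Data.List.Relation.Unary.Any using (here; there)
open import Data.Nat using (ℕ; zero; suc; _+_; _*_; _^_; _≤_; _<_; z≤n; s≤s; _≡ᵇ_; _≤ᵇ_)
open import Data.Nat.Properties as ℕ hiding (_≟_; suc-injective)
open import Data.Nat.Tactic.RingSolver using (solve-∀)
open import Data.Product using (∃; _×_; _,_; proj₁; proj₂)
open import Data.Rational.Unnormalised.Base using (_≃_; *≡*; _/_; 1ℚᵘ) renaming (_+_ to _+ᵘ_)
open import Data.Sum using (_⊎_; inj₁; inj₂)
open import Data.Vec.Base using (tabulate) renaming (_∷_ to _∷ᵥ_)
open import Data.Vec.Functional using (updateAt)
open import Data.Vec.Functional.Properties using (updateAt-updates; updateAt-minimal)
open import Function using (_∘_; const; mk⇔)
open import Relation.Binary.PropositionalEquality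
open import Relation.Nullary using (¬_; Dec; yes; no; does; contradiction)
open import Relation.Nullary.Decidable using (_→-dec_; dec-true; dec-false; does-⇔)

open import Algebra.Properties.Semiring.Sum +-*-semiring using (sum; ∑-distrib-+; ∑-comm; sum-remove; sum-cong-≗; sum-replicate-zero; *-distribˡ-sum; *-distribʳ-sum)

-- The formula for k is fitted to cocliques: k exceeds (m + 1)(λ + 1) - (m + 1)m/2 · L, the
-- inclusion-exclusion bound for the union of m + 1 sets nb y, by only 1 + (m + 1)(m - 2)/2. One
-- more such set would add at least λ + 1 - (m + 1) L, which is too much. The condition (2n + 1) L <
-- λ + 1 is spent twice. P i has at least λ + 1 - nL vertices, and the exchange needs more than (n +
-- 1) L, because a vertex of Δ may lie in all n + 1 sets nb y. A line has at least λ + 2 - nL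
-- vertices, and twice that must exceed λ + L + 3. Both demands are the same inequality. For m = n =
-- 4 it would read 729 < 570: only 246 vertices are certain in P i where more than 405 are wanted,
-- and only 247 on a line where 327 are wanted.

true-or-false : ∀ b → b ≡ true ⊎ b ≡ false
true-or-false true  = inj₁ refl
true-or-false false = inj₂ refl

clash : ∀ {b} {A : Set} → b ≡ true → b ≡ false → A
clash refl ()

does-true : ∀ {A : Set} (a? : Dec A) → does a? ≡ true → A
does-true (yes a) _ = a

does-false : ∀ {A : Set} (a? : Dec A) → does a? ≡ false → ¬ A
does-false (no ¬a) _ = ¬a

∧-true : ∀ {a b} → a ≡ true → b ≡ true → a ∧ b ≡ true
∧-true refl refl = refl

∨-trueʳ : ∀ a {b} → b ≡ true → a ∨ b ≡ true
∨-trueʳ a refl = Bool.∨-zeroʳ a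

∨-true : ∀ a {b} → a ∨ b ≡ true → a ≡ true ⊎ b ≡ true
∨-true true  _ = inj₁ refl
∨-true false b = inj₂ b

-- Indicators, finite sums and sizes of finite sets.

ind : Bool → ℕ
ind b = if b then 1 else 0

ind≤ : ∀ b {m} → (b ≡ true → 1 ≤ m) → ind b ≤ m
ind≤ true  h = h refl
ind≤ false h = z≤n

ind≤1 : ∀ b → ind b ≤ 1
ind≤1 b = ind≤ b (λ _ → ≤-refl)

1≤ind : ∀ {b} → b ≡ true → 1 ≤ ind b
1≤ind refl = ≤-refl

≤ind* : ∀ {b} c → b ≡ true → c ≤ ind b * c
≤ind* c refl = m≤m+n c 0

ind-positive : ∀ {b} → 0 < ind b → b ≡ true
ind-positive {true} _ = refl

ind≡0 : ∀ {b} → ind b ≡ 0 → b ≡ false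
ind≡0 {false} _ = refl

ind-∧ : ∀ a b → ind (a ∧ b) ≡ ind a * ind b
ind-∧ true  b = sym (+-identityʳ (ind b))
ind-∧ false b = refl

sum-mono : ∀ {n} {f g : Fin n → ℕ} → (∀ i → f i ≤ g i) → sum f ≤ sum g
sum-mono {zero}  h = z≤n
sum-mono {suc n} h = +-mono-≤ (h zero) (sum-mono (h ∘ suc))

sum-bounded : ∀ {n} {f : Fin n → ℕ} c → (∀ i → f i ≤ c) → sum f ≤ n * c
sum-bounded {zero}  c h = z≤n
sum-bounded {suc n} c h = +-mono-≤ (h zero) (sum-bounded c (h ∘ suc))

sum-bounded-below : ∀ {n} {f : Fin n → ℕ} c → (∀ i → c ≤ f i) → n * c ≤ sum f
sum-bounded-below {zero}  c h = z≤n
sum-bounded-below {suc n} c h = +-mono-≤ (h zero) (sum-bounded-below c (h ∘ suc))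

term≤sum : ∀ {n} (f : Fin n → ℕ) i → f i ≤ sum f
term≤sum f zero    = m≤m+n _ _
term≤sum f (suc i) = ≤-trans (term≤sum (f ∘ suc) i) (m≤n+m _ _)

two-terms≤sum : ∀ {n} (f : Fin n → ℕ) {i j} → i ≢ j → f i + f j ≤ sum f
two-terms≤sum {suc n} f {i} {j} i≢j = begin
  f i + f j                           ≡⟨ cong (λ l → f i + f l) (sym (punchIn-punchOut i≢j)) ⟩
  f i + f (punchIn i (punchOut i≢j))  ≤⟨ +-monoʳ-≤ (f i) (term≤sum (f ∘ punchIn i) (punchOut i≢j)) ⟩
  f i + sum (f ∘ punchIn i)           ≡⟨ sym (sum-remove f) ⟩
  sum f                               ∎
  where open ≤-Reasoning

sum≡0⇒term≡0 : ∀ {n} (f : Fin n → ℕ) → sum f ≡ 0 → ∀ i → f i ≡ 0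
sum≡0⇒term≡0 f eq i = n≤0⇒n≡0 (≤-trans (term≤sum f i) (≤-reflexive eq))

terms≡0⇒sum≡0 : ∀ {n} (f : Fin n → ℕ) → (∀ i → f i ≡ 0) → sum f ≡ 0
terms≡0⇒sum≡0 {n} f h = trans (sum-cong-≗ h) (sum-replicate-zero n)

sum-<⇒∃ : ∀ {n} (f g : Fin n → ℕ) → sum f < sum g → ∃ λ i → f i < g i
sum-<⇒∃ {suc n} f g lt with f zero <? g zero
... | yes f<g = zero , f<g
... | no  f≮g =
  let i , fi<gi = sum-<⇒∃ (f ∘ suc) (g ∘ suc)
        (+-cancelˡ-< (f zero) _ _ (<-≤-trans lt (+-monoˡ-≤ _ (≮⇒≥ f≮g))))
  in suc i , fi<gi

infix 8 #_

#_ : ∀ {n} → (Fin n → Bool) → ℕ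
# S = sum (ind ∘ S)

#-mono : ∀ {n} {S T : Fin n → Bool} → (∀ w → S w ≡ true → T w ≡ true) → # S ≤ # T
#-mono {S = S} h = sum-mono (λ w → ind≤ (S w) (λ w∈S → 1≤ind (h w w∈S)))

#-empty : ∀ {n} {S : Fin n → Bool} → (∀ w → S w ≡ false) → # S ≡ 0
#-empty {S = S} h = terms≡0⇒sum≡0 (ind ∘ S) (λ w → cong ind (h w))

#-nonempty : ∀ {n} {S : Fin n → Bool} → 0 < # S → ∃ λ w → S w ≡ true
#-nonempty {n} {S} 0<#S =
  let w , 0<S = sum-<⇒∃ (const 0) (ind ∘ S) (subst (_< # S) (sym (sum-replicate-zero n)) 0<#S)
  in w , ind-positive 0<S

#-singleton : ∀ {n} (a : Fin n) → # (λ w → does (a ≟ w)) ≡ 1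
#-singleton {suc n} zero    = cong suc (sum-replicate-zero n)
#-singleton {suc n} (suc a) = #-singleton a

#-avoiding : ∀ {n l} (S : Fin n → Bool) (F : Fin l → Fin n → Bool) →
  sum (λ j → # (λ w → S w ∧ F j w)) < # S →
  ∃ λ w → S w ≡ true × (∀ j → F j w ≡ false)
#-avoiding S F lt
  -- Union bound: once the two sums are exchanged, some point of `S` lies in fewer than one of the
  -- sets `F j`.
  with w , lt′ ← sum-<⇒∃ (λ w → sum (λ j → ind (S w ∧ F j w))) (ind ∘ S)
                   (subst (_< # S) (sym (∑-comm (λ w j → ind (S w ∧ F j w)))) lt)
  with w∈S ← ind-positive (≤-<-trans z≤n lt′)
  = w , w∈S , λ j → ind≡0 (trans (cong (λ b → ind (b ∧ F j w)) (sym w∈S))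
      (sum≡0⇒term≡0 (λ j → ind (S w ∧ F j w))
        (n<1⇒n≡0 (<-≤-trans lt′ (ind≤1 (S w)))) j))

sum-ind-* : ∀ {n} (S : Fin n → Bool) c → sum (λ w → ind (S w) * c) ≡ # S * c
sum-ind-* S c = sym (*-distribʳ-sum c (ind ∘ S))

-- The binomial coefficient n over 2.
tri : ℕ → ℕ
tri zero    = 0
tri (suc n) = n + tri n

-- Strongly regular graphs as Boolean adjacency with counts.

-- ℓ stands for λ and L for μ - 1.
record CountedGraph (v k ℓ L : ℕ) : Set where
  field
    adj        : Fin v → Fin v → Bool
    adj-sym    : ∀ a b → adj a b ≡ adj b a
    adj-irrefl : ∀ a → adj a a ≡ false
    degree     : ∀ a → # (adj a) ≡ k

  near : Fin v → Fin v → Bool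
  near a b = does (a ≟ b) ∨ adj a b

  field
    common-near : ∀ a b → adj a b ≡ true → # (λ w → adj a w ∧ adj b w) ≡ ℓ
    common-far  : ∀ a b u → near a b ≡ false → adj a u ≡ true → adj b u ≡ true →
                  # (λ w → adj a w ∧ adj b w) ≡ suc L

  near-sym : ∀ a b → near a b ≡ near b a
  near-sym a b with a ≟ b | b ≟ a
  ... | yes _   | yes _   = refl
  ... | yes a≡b | no  b≢a = contradiction (sym a≡b) b≢a
  ... | no  a≢b | yes b≡a = contradiction (sym b≡a) a≢b
  ... | no  _   | no  _   = adj-sym a b

  far-sym : ∀ {a b} → near a b ≡ false → near b a ≡ false
  far-sym {a} {b} = trans (near-sym b a)

  near-refl : ∀ a → near a a ≡ true
  near-refl a = cong (_∨ adj a a) (dec-true (a ≟ a) refl)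

  near-cases : ∀ {a b} → near a b ≡ true → a ≡ b ⊎ adj a b ≡ true
  near-cases {a} {b} h with ∨-true (does (a ≟ b)) h
  ... | inj₁ e = inj₁ (does-true (a ≟ b) e)
  ... | inj₂ e = inj₂ e

  adj⇒near : ∀ {a b} → adj a b ≡ true → near a b ≡ true
  adj⇒near {a} {b} = ∨-trueʳ (does (a ≟ b))

-- Cocliques in the neighbourhood of a vertex.

module Local {v k ℓ L : ℕ} (Γ : CountedGraph v k ℓ L) (x : Fin v) where
  open CountedGraph Γ

  V : Set
  V = Fin v

  nb : V → V → Bool
  nb y w = adj x w ∧ near y w

  nb-intro : ∀ {y w} → adj x w ≡ true → near y w ≡ true → nb y w ≡ true
  nb-intro = ∧-true

  nb-adj : ∀ {y w} → nb y w ≡ true → adj x w ≡ true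
  nb-adj = ∧-conicalˡ _ _

  nb-near : ∀ {y w} → nb y w ≡ true → near y w ≡ true
  nb-near {y} {w} = ∧-conicalʳ (adj x w) _

  far⇒∉nb : ∀ {y w} → near y w ≡ false → nb y w ≡ false
  far⇒∉nb {y} {w} e = trans (cong (adj x w ∧_) e) (∧-zeroʳ (adj x w))

  ∉nb⇒far : ∀ {y w} → adj x w ≡ true → nb y w ≡ false → near y w ≡ false
  ∉nb⇒far {y} {w} xw e = trans (cong (_∧ near y w) (sym xw)) e

  #nb : ∀ {y} → adj x y ≡ true → # (nb y) ≡ suc ℓ
  #nb {y} xy = begin
    # (nb y)
      ≡⟨ sum-cong-≗ split ⟩
    sum (λ w → ind (adj x w ∧ adj y w) + ind (does (y ≟ w)))
      ≡⟨ ∑-distrib-+ (λ w → ind (adj x w ∧ adj y w)) (λ w → ind (does (y ≟ w))) ⟩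
    # (λ w → adj x w ∧ adj y w) + # (λ w → does (y ≟ w))
      ≡⟨ cong₂ _+_ (common-near x y xy) (#-singleton y) ⟩
    ℓ + 1
      ≡⟨ +-comm ℓ 1 ⟩
    suc ℓ ∎
    where
    open ≡-Reasoning
    split : ∀ w → ind (nb y w) ≡ ind (adj x w ∧ adj y w) + ind (does (y ≟ w))
    split w with y ≟ w
    ... | yes refl rewrite xy | adj-irrefl y = refl
    ... | no  _    = sym (+-identityʳ _)

  -- One of the `L + 1` common neighbours of `y` and `z` is `x`, which is not in its own
  -- neighbourhood. Passing to closed neighbourhoods adds nothing, since neither of `y` and `z` is
  -- near the other.
  #nb∩nb : ∀ {y z} → adj x y ≡ true → adj x z ≡ true → near y z ≡ false →
           # (λ w → nb y w ∧ nb z w) ≤ L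
  #nb∩nb {y} {z} xy xz y≁z = ≤-pred (begin
    suc (# (λ w → nb y w ∧ nb z w))
      ≡⟨ cong (_+ # (λ w → nb y w ∧ nb z w)) (sym (#-singleton x)) ⟩
    # (λ w → does (x ≟ w)) + # (λ w → nb y w ∧ nb z w)
      ≡⟨ sym (∑-distrib-+ (λ w → ind (does (x ≟ w))) (λ w → ind (nb y w ∧ nb z w))) ⟩
    sum (λ w → ind (does (x ≟ w)) + ind (nb y w ∧ nb z w))
      ≤⟨ sum-mono split ⟩
    # (λ w → adj y w ∧ adj z w)
      ≡⟨ common-far y z x y≁z (trans (adj-sym y x) xy) (trans (adj-sym z x) xz) ⟩
    suc L ∎)
    where
    open ≤-Reasoning
    both : ∀ w → nb y w ∧ nb z w ≡ true → adj y w ∧ adj z w ≡ true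
    both w h with near-cases (nb-near {y} {w} (∧-conicalˡ _ _ h)) | near-cases (nb-near {z} {w} (∧-conicalʳ (nb y w) _ h))
    ... | inj₁ refl | _         = clash (trans (near-sym y z) (nb-near {z} {w} (∧-conicalʳ (nb y w) _ h))) y≁z
    ... | _         | inj₁ refl = clash (nb-near {y} {w} (∧-conicalˡ _ _ h)) y≁z
    ... | inj₂ yw   | inj₂ zw   = ∧-true yw zw
    split : ∀ w → ind (does (x ≟ w)) + ind (nb y w ∧ nb z w) ≤ ind (adj y w ∧ adj z w)
    split w with x ≟ w
    ... | yes refl rewrite adj-irrefl x | adj-sym y x | adj-sym z x | xy | xz = ≤-refl
    ... | no  _    = ind≤ (nb y w ∧ nb z w) (λ h → 1≤ind (both w h))

  record Coclique (n : ℕ) : Set where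
    field
      vertex : Fin n → V
      inside : ∀ i → adj x (vertex i) ≡ true
      indep  : ∀ {i j} → i ≢ j → near (vertex i) (vertex j) ≡ false

  open Coclique

  empty : Coclique 0
  empty = record { vertex = λ () ; inside = λ () ; indep = λ {} }

  cons : ∀ {n} b → adj x b ≡ true → (Y : Coclique n) →
         (∀ j → near b (vertex Y j) ≡ false) → Coclique (suc n)
  cons b xb Y far .vertex zero    = b
  cons b xb Y far .vertex (suc j) = vertex Y j
  cons b xb Y far .inside zero    = xb
  cons b xb Y far .inside (suc j) = inside Y j
  cons b xb Y far .indep {zero}  {zero}  i≢j = contradiction refl i≢j
  cons b xb Y far .indep {zero}  {suc j} i≢j = far j
  cons b xb Y far .indep {suc i} {zero}  i≢j = far-sym (far i)
  cons b xb Y far .indep {suc i} {suc j} i≢j = indep Y (i≢j ∘ cong suc)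

  reindex : ∀ {m n} (ρ : Fin m → Fin n) → (∀ {i j} → ρ i ≡ ρ j → i ≡ j) → Coclique n → Coclique m
  reindex ρ inj Y .vertex = vertex Y ∘ ρ
  reindex ρ inj Y .inside = inside Y ∘ ρ
  reindex ρ inj Y .indep i≢j = indep Y (i≢j ∘ inj)

  tail : ∀ {n} → Coclique (suc n) → Coclique n
  tail = reindex suc suc-injective

  remove : ∀ {n} → Fin (suc n) → Coclique (suc n) → Coclique n
  remove i = reindex (punchIn i) (punchIn-injective i _ _)

  replace : ∀ {n} (Y : Coclique n) i p → adj x p ≡ true →
            (∀ j → j ≢ i → near (vertex Y j) p ≡ false) → Coclique n
  replace {n} Y i p xp far = record { vertex = y ; inside = y-inside ; indep = y-indep }
    where
    y : Fin n → V
    y = updateAt (vertex Y) i (const p)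
    at-i : y i ≡ p
    at-i = updateAt-updates i (vertex Y)
    off-i : ∀ {j} → j ≢ i → y j ≡ vertex Y j
    off-i {j} j≢i = updateAt-minimal j i (vertex Y) j≢i
    y-inside : ∀ j → adj x (y j) ≡ true
    y-inside j with j ≟ i
    ... | yes refl = trans (cong (adj x) at-i) xp
    ... | no  j≢i  = trans (cong (adj x) (off-i j≢i)) (inside Y j)
    y-indep : ∀ {j l} → j ≢ l → near (y j) (y l) ≡ false
    y-indep {j} {l} j≢l with j ≟ i | l ≟ i
    ... | yes refl | yes refl = contradiction refl j≢l
    ... | yes refl | no  l≢i  = trans (cong₂ near at-i (off-i l≢i)) (far-sym (far l l≢i))
    ... | no  j≢i  | yes refl = trans (cong₂ near (off-i j≢i) at-i) (far j j≢i)
    ... | no  j≢i  | no  l≢i  = trans (cong₂ near (off-i j≢i) (off-i l≢i)) (indep Y j≢l)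

  deg : ∀ {n} → Coclique n → V → ℕ
  deg Y w = sum (λ l → ind (nb (vertex Y l) w))

  #nb∩deg : ∀ {n} (Y : Coclique n) a → adj x a ≡ true → (∀ j → near a (vertex Y j) ≡ false) →
            sum (λ w → ind (nb a w) * deg Y w) ≤ n * L
  #nb∩deg Y a xa far = begin
    sum (λ w → ind (nb a w) * deg Y w)
      ≡⟨ sum-cong-≗ (λ w → distrib w) ⟩
    sum (λ w → sum (λ l → ind (nb a w ∧ nb (vertex Y l) w)))
      ≡⟨ ∑-comm (λ w l → ind (nb a w ∧ nb (vertex Y l) w)) ⟩
    sum (λ l → # (λ w → nb a w ∧ nb (vertex Y l) w))
      ≤⟨ sum-bounded L (λ l → #nb∩nb xa (inside Y l) (far l)) ⟩
    _ ∎
    where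
    open ≤-Reasoning
    distrib : ∀ w → ind (nb a w) * deg Y w ≡ sum (λ l → ind (nb a w ∧ nb (vertex Y l) w))
    distrib w = trans (*-distribˡ-sum (ind (nb a w)) (λ l → ind (nb (vertex Y l) w)))
      (sum-cong-≗ (λ l → sym (ind-∧ (nb a w) (nb (vertex Y l) w))))

  tri-ind : ∀ b d → tri (ind b + d) ≡ ind b * d + tri d
  tri-ind true  d = cong (_+ tri d) (sym (+-identityʳ d))
  tri-ind false d = refl

  -- `tri (deg Y w)` counts the pairs of members whose closed neighbourhoods both contain `w`, and
  -- each of the `tri n` pairs has at most `L` such `w`. The induction collects the pairs that
  -- involve the first member.
  sum-tri-deg : ∀ {n} (Y : Coclique n) → sum (λ w → tri (deg Y w)) ≤ tri n * L
  sum-tri-deg {zero}  Y = ≤-reflexive (terms≡0⇒sum≡0 (λ w → tri (deg Y w)) (λ w → refl))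
  sum-tri-deg {suc n} Y = begin
    sum (λ w → tri (deg Y w))
      ≡⟨ sum-cong-≗ (λ w → tri-ind (nb (vertex Y zero) w) (deg (tail Y) w)) ⟩
    sum (λ w → ind (nb (vertex Y zero) w) * deg (tail Y) w + tri (deg (tail Y) w))
      ≡⟨ ∑-distrib-+ (λ w → ind (nb (vertex Y zero) w) * deg (tail Y) w) _ ⟩
    sum (λ w → ind (nb (vertex Y zero) w) * deg (tail Y) w) + sum (λ w → tri (deg (tail Y) w))
      ≤⟨ +-mono-≤ (#nb∩deg (tail Y) (vertex Y zero) (inside Y zero) (λ j → indep Y (λ ())))
                  (sum-tri-deg (tail Y)) ⟩
    n * L + tri n * L
      ≡⟨ sym (*-distribʳ-+ L n (tri n)) ⟩
    (n + tri n) * L ∎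
    where open ≤-Reasoning

  sum-deg : ∀ {n} (Y : Coclique n) → sum (deg Y) ≡ n * suc ℓ
  sum-deg {n} Y = trans (∑-comm (λ w l → ind (nb (vertex Y l) w)))
    (trans (sum-cong-≗ (λ l → #nb (inside Y l))) (const-sum n))
    where
    const-sum : ∀ n → sum {n} (const (suc ℓ)) ≡ n * suc ℓ
    const-sum zero    = refl
    const-sum (suc n) = cong (suc ℓ +_) (const-sum n)

  -- Bonferroni inequalities, obtained by summing a pointwise inequality in the number `deg Y w`. In
  -- the uses, `g` is the indicator of a set that contains the union, and `f` records a surplus at
  -- vertices that are covered often.
  bonferroni : ∀ {n} (Y : Coclique n) (f g : V → ℕ) →
    (∀ w → deg Y w + f w ≤ g w + tri (deg Y w)) →
    n * suc ℓ + sum f ≤ sum g + tri n * L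
  bonferroni {n} Y f g h = begin
    n * suc ℓ + sum f                     ≡⟨ cong (_+ sum f) (sym (sum-deg Y)) ⟩
    sum (deg Y) + sum f                   ≡⟨ sym (∑-distrib-+ (deg Y) f) ⟩
    sum (λ w → deg Y w + f w)             ≤⟨ sum-mono h ⟩
    sum (λ w → g w + tri (deg Y w))       ≡⟨ ∑-distrib-+ g _ ⟩
    sum g + sum (λ w → tri (deg Y w))     ≤⟨ +-monoʳ-≤ (sum g) (sum-tri-deg Y) ⟩
    sum g + tri n * L                     ∎
    where open ≤-Reasoning

  deg-positive : ∀ {n} (Y : Coclique n) w → 0 < deg Y w → ∃ λ l → nb (vertex Y l) w ≡ true
  deg-positive Y w = #-nonempty {S = λ l → nb (vertex Y l) w}

  deg-remove : ∀ {n} (Y : Coclique (suc n)) i w → deg Y w ≡ ind (nb (vertex Y i) w) + deg (remove i Y) w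
  deg-remove Y i w = sum-remove {i = i} (λ l → ind (nb (vertex Y l) w))

  deg≤adj+tri : ∀ {n} (Y : Coclique n) w → deg Y w ≤ ind (adj x w) + tri (deg Y w)
  deg≤adj+tri Y w with deg Y w in eq
  ... | zero  = z≤n
  ... | suc d with l , h ← deg-positive Y w (subst (0 <_) (sym eq) (s≤s z≤n)) =
    +-mono-≤ (1≤ind (nb-adj {vertex Y l} {w} h)) (m≤m+n d (tri d))

  clawBound : ∀ {n} → Coclique n → n * suc ℓ ≤ k + tri n * L
  clawBound {n} Y = begin
    n * suc ℓ                  ≡⟨ sym (+-identityʳ _) ⟩
    n * suc ℓ + 0              ≡⟨ cong (n * suc ℓ +_) (sym (sum-replicate-zero v)) ⟩
    n * suc ℓ + sum {v} (const 0) ≤⟨ bonferroni Y (const 0) (ind ∘ adj x)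
                                     (λ w → ≤-trans (≤-reflexive (+-identityʳ _)) (deg≤adj+tri Y w)) ⟩
    # (adj x) + tri n * L      ≡⟨ cong (_+ tri n * L) (degree x) ⟩
    k + tri n * L              ∎
    where open ≤-Reasoning

  -- Descent on the impossible size. Whether a coclique can be enlarged is never decided, so the
  -- growth hypothesis is doubly negated; this is harmless because the goal is `⊥`.
  maximum-coclique : ∀ N → ¬ Coclique N → (∀ n → n < N → Coclique n → ¬ ¬ Coclique (suc n)) → ⊥
  maximum-coclique zero    none grow = none empty
  maximum-coclique (suc N) none grow = maximum-coclique N (λ Y → grow N ≤-refl Y none)
    (λ n n<N → grow n (m<n⇒m<1+n n<N))

  -- Private cliques and lines of a maximum coclique.

  module Maximum {n : ℕ} (Y : Coclique (suc n)) (maximum : ¬ Coclique (suc (suc n))) where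

    y : Fin (suc n) → V
    y = vertex Y

    P : Fin (suc n) → V → Bool
    P i w = nb (y i) w ∧ (deg Y w ≡ᵇ 1)

    P⊆nb : ∀ i {w} → P i w ≡ true → nb (y i) w ≡ true
    P⊆nb i = ∧-conicalˡ _ _

    P⊆Δ : ∀ i {w} → P i w ≡ true → adj x w ≡ true
    P⊆Δ i {w} h = nb-adj {y i} {w} (P⊆nb i h)

    P-deg : ∀ i {w} → P i w ≡ true → deg Y w ≡ 1
    P-deg i {w} h = ≡ᵇ⇒≡ _ _ (subst T (sym (∧-conicalʳ (nb (y i) w) _ h)) _)

    P-far : ∀ i {w} → P i w ≡ true → ∀ {l} → l ≢ i → near (y l) w ≡ false
    P-far i {w} h {l} l≢i with true-or-false (nb (y l) w)
    ... | inj₂ e = ∉nb⇒far (P⊆Δ i h) e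
    ... | inj₁ e = contradiction (begin
      2                                        ≤⟨ +-mono-≤ (1≤ind e) (1≤ind (P⊆nb i h)) ⟩
      ind (nb (y l) w) + ind (nb (y i) w)      ≤⟨ two-terms≤sum (λ j → ind (nb (y j) w)) l≢i ⟩
      deg Y w                                  ≡⟨ P-deg i h ⟩
      1                                        ∎) (λ { (s≤s ()) })
      where open ≤-Reasoning

    y∈nb : ∀ i → nb (y i) (y i) ≡ true
    y∈nb i = nb-intro (inside Y i) (near-refl (y i))

    y∈P : ∀ i → P i (y i) ≡ true
    y∈P i = ∧-true (y∈nb i) (cong (_≡ᵇ 1) (trans (deg-remove Y i (y i))
      (cong₂ _+_ (cong ind (y∈nb i))
        (terms≡0⇒sum≡0 _ (λ l → cong ind (far⇒∉nb {y (punchIn i l)} {y i} (indep Y (punchInᵢ≢i i l))))))))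

    no-extension : ∀ (Y′ : Coclique (suc n)) b → adj x b ≡ true → ¬ (∀ j → near b (vertex Y′ j) ≡ false)
    no-extension Y′ b xb far = maximum (cons b xb Y′ far)

    -- Otherwise `q` could take the place of `y i` and `p` could be added: both are far from all
    -- other members.
    P-clique : ∀ i {p q} → P i p ≡ true → P i q ≡ true → near p q ≡ true
    P-clique i {p} {q} p∈P q∈P with true-or-false (near p q)
    ... | inj₁ e = e
    ... | inj₂ p≁q = ⊥-elim (no-extension
      (replace Y i q (P⊆Δ i q∈P) (λ j j≢i → P-far i q∈P j≢i)) p (P⊆Δ i p∈P) far)
      where
      far : ∀ j → near p (updateAt y i (const q) j) ≡ false
      far j with j ≟ i
      ... | yes refl = trans (cong (near p) (updateAt-updates i y)) p≁q
      ... | no  j≢i  = trans (cong (near p) (updateAt-minimal j i y j≢i)) (far-sym (P-far i p∈P j≢i))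

    #P-lower : ∀ i → suc ℓ ≤ # (P i) + n * L
    #P-lower i = begin
      suc ℓ
        ≡⟨ sym (#nb (inside Y i)) ⟩
      # (nb (y i))
        ≤⟨ sum-mono split ⟩
      sum (λ w → ind (P i w) + ind (nb (y i) w) * deg (remove i Y) w)
        ≡⟨ ∑-distrib-+ (ind ∘ P i) _ ⟩
      # (P i) + sum (λ w → ind (nb (y i) w) * deg (remove i Y) w)
        ≤⟨ +-monoʳ-≤ (# (P i)) (#nb∩deg (remove i Y) (y i) (inside Y i)
             (λ j → indep Y (punchInᵢ≢i i j ∘ sym))) ⟩
      # (P i) + n * L ∎
      where
      open ≤-Reasoning
      split : ∀ w → ind (nb (y i) w) ≤ ind (P i w) + ind (nb (y i) w) * deg (remove i Y) w
      split w with nb (y i) w | deg-remove Y i w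
      ... | false | _ = z≤n
      ... | true  | e rewrite e with deg (remove i Y) w
      ... | zero  = ≤-refl
      ... | suc d = s≤s z≤n

    -- One vertex `w` of `P i` far from `u` is enough: the clique `P i` lies inside `nb w`, so the
    -- pair `w`, `u` bounds the count.
    #P∩nb : ∀ i {u w} → adj x u ≡ true → P i w ≡ true → near u w ≡ false →
            # (λ p → P i p ∧ nb u p) ≤ L
    #P∩nb i {u} {w} xu w∈P u≁w = ≤-trans
      (#-mono {S = λ p → P i p ∧ nb u p} {T = λ p → nb w p ∧ nb u p} (λ p h →
        let p∈P = ∧-conicalˡ (P i p) _ h in
        ∧-true (nb-intro (P⊆Δ i p∈P) (P-clique i w∈P p∈P)) (∧-conicalʳ (P i p) _ h)))
      (#nb∩nb (P⊆Δ i w∈P) xu (far-sym u≁w))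

    full? : ∀ i b → Dec (∀ w → P i w ≡ true → near b w ≡ true)
    full? i b = all? (λ w → (P i w Bool.≟ true) →-dec (near b w Bool.≟ true))

    full : Fin (suc n) → V → Bool
    full i b = does (full? i b)

    full-near : ∀ i {b w} → full i b ≡ true → P i w ≡ true → near b w ≡ true
    full-near i {b} {w} h = does-true (full? i b) h w

    full⇒nb : ∀ i {b} → adj x b ≡ true → full i b ≡ true → nb (y i) b ≡ true
    full⇒nb i {b} xb h = nb-intro xb (trans (near-sym (y i) b) (full-near i h (y∈P i)))

    P⊆full : ∀ i {w} → P i w ≡ true → full i w ≡ true
    P⊆full i {w} h = dec-true (full? i w) (λ _ → P-clique i h)

    not-full : ∀ i {b} → full i b ≡ false → ∃ λ w → P i w ≡ true × near b w ≡ false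
    not-full i {b} h
      with w , ¬imp ← ¬∀⟶∃¬ _ _ (λ w → (P i w Bool.≟ true) →-dec (near b w Bool.≟ true)) (does-false (full? i b) h)
      with true-or-false (P i w) | true-or-false (near b w)
    ... | inj₁ w∈P | inj₂ b≁w = w , w∈P , b≁w
    ... | _        | inj₁ b~w = contradiction (λ _ → b~w) ¬imp
    ... | inj₂ w∉P | _        = contradiction (λ w∈P → clash w∈P w∉P) ¬imp

    -- If b were full on no P i, then each y i near b could be exchanged for some
    -- p ∈ P i far from b and from the vertices exchanged before; the
    -- resulting coclique would be extended by b.
    full-somewhere : ∀ {b} → adj x b ≡ true → (∀ i → deg Y b * L < # (P i)) → ∃ λ i → full i b ≡ true
    full-somewhere {b} xb big with any? (λ i → full i b Bool.≟ true)
    ... | yes found = found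
    ... | no  none  = ⊥-elim (no-extension (proj₁ final) b xb (λ j → proj₁ (proj₂ final) j (∈-allFin j)))
      where
      witness : ∀ i → ∃ λ w → P i w ≡ true × near b w ≡ false
      witness i with true-or-false (full i b)
      ... | inj₁ h = contradiction (i , h) none
      ... | inj₂ h = not-full i h

      -- The last two clauses prepare later exchanges: a member in `P j` with `j ≢ t` is far from
      -- `y t`, so it is near at most `L` vertices of `P t`; a member that is still `y j` is far
      -- from all of `P t`.
      Exchanged : List (Fin (suc n)) → Set
      Exchanged s = ∃ λ (Y′ : Coclique (suc n)) →
        (∀ j → j ∈ s → near b (vertex Y′ j) ≡ false) ×
        (∀ j → P j (vertex Y′ j) ≡ true) ×
        (∀ j → near b (y j) ≡ false → vertex Y′ j ≡ y j)

      exchange : ∀ t {s} → Exchanged s → Exchanged (t ∷ s)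
      exchange t {s} (Y′ , away , private′ , same) with true-or-false (near b (vertex Y′ t))
      ... | inj₂ b≁t = Y′ , (λ { j (here refl) → b≁t ; j (there j∈s) → away j j∈s }) , private′ , same
      ... | inj₁ b~t = replace Y′ t p xp far , away′ , private″ , same′
        where
        y′ = vertex Y′

        b~yₜ : near b (y t) ≡ true
        b~yₜ with true-or-false (near b (y t))
        ... | inj₁ e = e
        ... | inj₂ e = clash b~t (trans (cong (near b) (same t e)) e)

        -- The vertices to be avoided by the replacement: the current members, with `b` itself in
        -- the vacated position `t`.
        u : Fin (suc n) → V
        u = updateAt y′ t (const b)

        u-inside : ∀ j → adj x (u j) ≡ true
        u-inside j with j ≟ t
        ... | yes refl = trans (cong (adj x) (updateAt-updates t y′)) xb
        ... | no  j≢t  = trans (cong (adj x) (updateAt-minimal j t y′ j≢t)) (inside Y′ j)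

        u-far : ∀ j → ∃ λ w → P t w ≡ true × near (u j) w ≡ false
        u-far j with j ≟ t
        ... | yes refl = let w , w∈P , b≁w = witness t in
                         w , w∈P , trans (cong (λ a → near a w) (updateAt-updates t y′)) b≁w
        ... | no  j≢t  = y t , y∈P t , trans (cong (λ a → near a (y t)) (updateAt-minimal j t y′ j≢t))
                                         (far-sym (P-far j (private′ j) (j≢t ∘ sym)))

        F : Fin (suc n) → V → Bool
        F j w = nb (y j) b ∧ nb (u j) w

        -- Only positions with `y j` near `b` cost anything, and there are `deg Y b` of them;
        -- elsewhere the member is still `y j` and avoids `P t` by itself.
        #P∩F : ∀ j → # (λ w → P t w ∧ F j w) ≤ ind (nb (y j) b) * L
        #P∩F j with nb (y j) b
        ... | true  = let w , w∈P , uⱼ≁w = u-far j in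
                      subst (# (λ p → P t p ∧ nb (u j) p) ≤_) (sym (+-identityʳ L)) (#P∩nb t (u-inside j) w∈P uⱼ≁w)
        ... | false = ≤-reflexive (#-empty {S = λ w → P t w ∧ false} (λ w → ∧-zeroʳ (P t w)))

        chosen : ∃ λ p → P t p ≡ true × (∀ j → F j p ≡ false)
        chosen = #-avoiding (P t) F (≤-<-trans
          (≤-trans (sum-mono #P∩F) (≤-reflexive (sum-ind-* (λ j → nb (y j) b) L))) (big t))

        p = proj₁ chosen
        p∈P = proj₁ (proj₂ chosen)
        avoids = proj₂ (proj₂ chosen)
        xp = P⊆Δ t p∈P

        avoid : ∀ j → near b (y j) ≡ true → near (u j) p ≡ false
        avoid j b~yⱼ = ∉nb⇒far xp (trans
          (cong (_∧ nb (u j) p) (sym (nb-intro {y j} {b} xb (trans (near-sym (y j) b) b~yⱼ)))) (avoids j))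

        far : ∀ j → j ≢ t → near (y′ j) p ≡ false
        far j j≢t with true-or-false (near b (y j))
        ... | inj₁ e = trans (cong (λ a → near a p) (sym (updateAt-minimal j t y′ j≢t))) (avoid j e)
        ... | inj₂ e = trans (cong (λ a → near a p) (same j e)) (P-far t p∈P j≢t)

        b≁p : near b p ≡ false
        b≁p = trans (cong (λ a → near a p) (sym (updateAt-updates t y′))) (avoid t b~yₜ)

        y″ = updateAt y′ t (const p)

        away′ : ∀ j → j ∈ t ∷ s → near b (y″ j) ≡ false
        away′ j j∈ with j ≟ t
        ... | yes refl = trans (cong (near b) (updateAt-updates t y′)) b≁p
        away′ j (here j≡t)  | no j≢t = contradiction j≡t j≢t
        away′ j (there j∈s) | no j≢t = trans (cong (near b) (updateAt-minimal j t y′ j≢t)) (away j j∈s)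

        private″ : ∀ j → P j (y″ j) ≡ true
        private″ j with j ≟ t
        ... | yes refl = trans (cong (P t) (updateAt-updates t y′)) p∈P
        ... | no  j≢t  = trans (cong (P j) (updateAt-minimal j t y′ j≢t)) (private′ j)

        same′ : ∀ j → near b (y j) ≡ false → y″ j ≡ y j
        same′ j b≁yⱼ with j ≟ t
        ... | yes refl = clash b~yₜ b≁yⱼ
        ... | no  j≢t  = trans (updateAt-minimal j t y′ j≢t) (same j b≁yⱼ)

      exchanges : ∀ s → Exchanged s
      exchanges []      = Y , (λ _ ()) , y∈P , (λ _ _ → refl)
      exchanges (t ∷ s) = exchange t (exchanges s)

      final : Exchanged (allFin (suc n))
      final = exchanges (allFin (suc n))

    line : Fin (suc n) → V → Bool
    line i w = does (x ≟ w) ∨ (adj x w ∧ full i w)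

    -- Two nonadjacent vertices full on `P i` would have all of `P i` in common, which is more than
    -- `L`.
    line-clique : ∀ i → L < # (P i) → ∀ {a b} → line i a ≡ true → line i b ≡ true → near a b ≡ true
    line-clique i big {a} {b} a∈ b∈
      with ∨-true (does (x ≟ a)) a∈ | ∨-true (does (x ≟ b)) b∈
    ... | inj₁ x≡a | inj₁ x≡b with refl ← does-true (x ≟ a) x≡a | refl ← does-true (x ≟ b) x≡b = near-refl x
    ... | inj₁ x≡a | inj₂ b∈′ with refl ← does-true (x ≟ a) x≡a = adj⇒near (∧-conicalˡ _ _ b∈′)
    ... | inj₂ a∈′ | inj₁ x≡b with refl ← does-true (x ≟ b) x≡b =
      trans (near-sym a x) (adj⇒near (∧-conicalˡ _ _ a∈′))
    ... | inj₂ a∈′ | inj₂ b∈′ with true-or-false (near a b)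
    ... | inj₁ a~b = a~b
    ... | inj₂ a≁b = contradiction big (≤⇒≯ (≤-trans
      (#-mono {S = P i} {T = λ w → nb a w ∧ nb b w} (λ w w∈P →
        ∧-true (nb-intro {a} {w} (P⊆Δ i w∈P) (full-near i (∧-conicalʳ (adj x a) _ a∈′) w∈P))
               (nb-intro {b} {w} (P⊆Δ i w∈P) (full-near i (∧-conicalʳ (adj x b) _ b∈′) w∈P))))
      (#nb∩nb (∧-conicalˡ _ _ a∈′) (∧-conicalˡ _ _ b∈′) a≁b)))

    #P<#line : ∀ i → # (P i) < # (line i)
    #P<#line i = begin
      suc (# (P i))
        ≡⟨ cong (_+ # (P i)) (sym (#-singleton x)) ⟩
      # (λ w → does (x ≟ w)) + # (P i)
        ≡⟨ sym (∑-distrib-+ (λ w → ind (does (x ≟ w))) (ind ∘ P i)) ⟩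
      sum (λ w → ind (does (x ≟ w)) + ind (P i w))
        ≤⟨ sum-mono split ⟩
      # (line i) ∎
      where
      open ≤-Reasoning
      split : ∀ w → ind (does (x ≟ w)) + ind (P i w) ≤ ind (line i w)
      split w with x ≟ w
      ... | no _ = ind≤ (P i w) (λ h → 1≤ind (∧-true (P⊆Δ i h) (P⊆full i h)))
      ... | yes refl with true-or-false (P i x)
      ... | inj₁ h = clash (P⊆Δ i h) (adj-irrefl x)
      ... | inj₂ h rewrite h = ≤-refl

    line-centre : ∀ i → line i x ≡ true
    line-centre i = cong (_∨ (adj x x ∧ full i x)) (dec-true (x ≟ x) refl)

  -- Overlap forced by inclusion-exclusion outside a coclique.

  out : ∀ {n} → Coclique n → V → Bool
  out R w = deg R w ≡ᵇ 0

  #out∩nb : ∀ {n} (R : Coclique n) a → adj x a ≡ true → (∀ j → near a (vertex R j) ≡ false) →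
            suc ℓ ≤ # (λ w → out R w ∧ nb a w) + n * L
  #out∩nb {n} R a xa far = begin
    suc ℓ
      ≡⟨ sym (#nb xa) ⟩
    # (nb a)
      ≤⟨ sum-mono split ⟩
    sum (λ w → ind (out R w ∧ nb a w) + ind (nb a w) * deg R w)
      ≡⟨ ∑-distrib-+ (λ w → ind (out R w ∧ nb a w)) _ ⟩
    # (λ w → out R w ∧ nb a w) + sum (λ w → ind (nb a w) * deg R w)
      ≤⟨ +-monoʳ-≤ (# (λ w → out R w ∧ nb a w)) (#nb∩deg R a xa far) ⟩
    # (λ w → out R w ∧ nb a w) + n * L ∎
    where
    open ≤-Reasoning
    split : ∀ w → ind (nb a w) ≤ ind (out R w ∧ nb a w) + ind (nb a w) * deg R w
    split w with nb a w | deg R w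
    ... | false | _     = z≤n
    ... | true  | zero  = ≤-refl
    ... | true  | suc d = s≤s z≤n

  #union : ∀ {n} (R : Coclique n) → n * suc ℓ ≤ # (not ∘ out R) + tri n * L
  #union {n} R = begin
    n * suc ℓ                     ≡⟨ sym (+-identityʳ _) ⟩
    n * suc ℓ + 0                 ≡⟨ cong (n * suc ℓ +_) (sym (sum-replicate-zero v)) ⟩
    n * suc ℓ + sum {v} (const 0) ≤⟨ bonferroni R (const 0) (ind ∘ not ∘ out R) split ⟩
    # (not ∘ out R) + tri n * L   ∎
    where
    open ≤-Reasoning
    split : ∀ w → deg R w + 0 ≤ ind (not (out R w)) + tri (deg R w)
    split w with deg R w
    ... | zero  = z≤n
    ... | suc d = s≤s (≤-trans (≤-reflexive (+-identityʳ d)) (m≤m+n d (tri d)))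

  not-out⇒adj : ∀ {n} (R : Coclique n) w → not (out R w) ≡ true → adj x w ≡ true
  not-out⇒adj R w h with deg R w in eq
  ... | suc d = let l , e = deg-positive R w (subst (0 <_) (sym eq) (s≤s z≤n)) in nb-adj {vertex R l} {w} e

  -- The union of the sets `nb (vertex R j)` and the parts of `nb a` and `nb b` outside it must fit
  -- into `k` vertices. Their sizes are bounded below, so whatever does not fit is forced into the
  -- common part of `nb a` and `nb b`.
  #common-out : ∀ {n} (R : Coclique n) a b → adj x a ≡ true → adj x b ≡ true →
    (∀ j → near a (vertex R j) ≡ false) → (∀ j → near b (vertex R j) ≡ false) →
    n * suc ℓ + (suc ℓ + suc ℓ) ≤
      (k + # (λ w → out R w ∧ (nb a w ∧ nb b w))) + (tri n * L + (n * L + n * L))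
  #common-out {n} R a b xa xb farᵃ farᵇ = begin
    n * suc ℓ + (suc ℓ + suc ℓ)
      ≤⟨ +-mono-≤ (#union R) (+-mono-≤ (#out∩nb R a xa farᵃ) (#out∩nb R b xb farᵇ)) ⟩
    (U + tri n * L) + ((A + n * L) + (B + n * L))
      ≡⟨ regroup U (tri n * L) A B (n * L) ⟩
    (U + (A + B)) + (tri n * L + (n * L + n * L))
      ≤⟨ +-monoˡ-≤ _ inclusion-exclusion ⟩
    (k + C) + (tri n * L + (n * L + n * L)) ∎
    where
    open ≤-Reasoning
    SA SB SC : V → Bool
    SA w = out R w ∧ nb a w
    SB w = out R w ∧ nb b w
    SC w = out R w ∧ (nb a w ∧ nb b w)
    U = # (not ∘ out R)
    A = # SA
    B = # SB
    C = # SC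
    regroup : ∀ u t a b n → (u + t) + ((a + n) + (b + n)) ≡ (u + (a + b)) + (t + (n + n))
    regroup = solve-∀
    split : ∀ w → ind (not (out R w)) + (ind (SA w) + ind (SB w)) ≤ ind (adj x w) + ind (SC w)
    split w with out R w | not-out⇒adj R w
    ... | false | h rewrite h refl = ≤-refl
    ... | true  | _ with adj x w | near a w | near b w
    ... | false | _     | _     = z≤n
    ... | true  | true  | true  = ≤-refl
    ... | true  | true  | false = ≤-refl
    ... | true  | false | true  = ≤-refl
    ... | true  | false | false = z≤n
    inclusion-exclusion : U + (A + B) ≤ k + C
    inclusion-exclusion = begin
      U + (A + B)
        ≡⟨ cong (U +_) (sym (∑-distrib-+ (ind ∘ SA) (ind ∘ SB))) ⟩
      U + sum (λ w → ind (SA w) + ind (SB w))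
        ≡⟨ sym (∑-distrib-+ (ind ∘ not ∘ out R) (λ w → ind (SA w) + ind (SB w))) ⟩
      sum (λ w → ind (not (out R w)) + (ind (SA w) + ind (SB w)))
        ≤⟨ sum-mono split ⟩
      sum (λ w → ind (adj x w) + ind (SC w))
        ≡⟨ ∑-distrib-+ (ind ∘ adj x) (ind ∘ SC) ⟩
      # (adj x) + C
        ≡⟨ cong (_+ C) (degree x) ⟩
      k + C ∎

-- Counting common neighbours of two nonadjacent vertices by lines.

record Lines {v k ℓ L : ℕ} (Γ : CountedGraph v k ℓ L) (N e : ℕ) (x : Fin v) : Set where
  open CountedGraph Γ
  field
    count       : ℕ
    count≤      : count ≤ N
    line        : Fin count → Fin v → Bool
    exceptional : Fin v → Bool
    centre      : ∀ i → line i x ≡ true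
    clique      : ∀ i {a b} → line i a ≡ true → line i b ≡ true → near a b ≡ true
    -- `ℓ + (L + 3)` is `(ℓ + 2) + (L + 1)`, the most that two lines on nonadjacent centres can
    -- total if they share two vertices. Doubling one line lets sizes be bounded one line at a time.
    large       : ∀ i → ℓ + (L + 3) < # (line i) + # (line i)
    few         : # exceptional ≤ e
    cover       : ∀ w → adj x w ≡ true → (∃ λ i → line i w ≡ true) ⊎ exceptional w ≡ true

module _ {v k ℓ L : ℕ} (Γ : CountedGraph v k ℓ L) where
  open CountedGraph Γ

  -- Two cliques that share two vertices have at most ℓ + 2 vertices in their
  -- union, and at most L + 1 in common if they contain nonadjacent x and z.
  line∩line : ∀ {x z u} → near x z ≡ false → adj x u ≡ true → adj z u ≡ true → (C D : Fin v → Bool) →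
    C x ≡ true → D z ≡ true →
    (∀ {a b} → C a ≡ true → C b ≡ true → near a b ≡ true) →
    (∀ {a b} → D a ≡ true → D b ≡ true → near a b ≡ true) →
    ℓ + (L + 3) < # C + # C → ℓ + (L + 3) < # D + # D →
    # (λ w → C w ∧ D w) ≤ 1
  line∩line {x} {z} {u} x≁z xu zu C D x∈C z∈D C-clique D-clique C-large D-large =
    ≮⇒≥ (λ 1<# →
      let a , a∈ = #-nonempty {S = λ w → C w ∧ D w} (<-trans (s≤s z≤n) 1<#)
          b , lt = sum-<⇒∃ (λ w → ind (does (a ≟ w))) (λ w → ind (C w ∧ D w))
                     (subst (_< # (λ w → C w ∧ D w)) (sym (#-singleton a)) 1<#)
          b∈ = ind-positive (≤-<-trans z≤n lt)
          a≢b = λ a≡b → <-irrefl refl (<-≤-trans (subst (λ t → ind t < ind (C b ∧ D b)) (dec-true (a ≟ b) a≡b) lt) (ind≤1 (C b ∧ D b)))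
      in impossible a b a≢b (∧-conicalˡ _ _ a∈) (∧-conicalʳ (C a) _ a∈) (∧-conicalˡ _ _ b∈) (∧-conicalʳ (C b) _ b∈))
    where
    module _ (a b : Fin v) (a≢b : a ≢ b) (a∈C : C a ≡ true) (a∈D : D a ≡ true) (b∈C : C b ≡ true) (b∈D : D b ≡ true) where
      ab : adj a b ≡ true
      ab with near-cases (C-clique a∈C b∈C)
      ... | inj₁ a≡b = contradiction a≡b a≢b
      ... | inj₂ h   = h

      to-ab : ∀ {S : Fin v → Bool} → S a ≡ true → S b ≡ true →
        (∀ {c d} → S c ≡ true → S d ≡ true → near c d ≡ true) → ∀ w → S w ≡ true →
        1 ≤ ind (adj a w ∧ adj b w) + (ind (does (a ≟ w)) + ind (does (b ≟ w)))
      to-ab a∈ b∈ cl w w∈ with near-cases (cl a∈ w∈) | near-cases (cl b∈ w∈)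
      ... | inj₁ a≡w | _        = ≤-trans (≤-trans (1≤ind (dec-true (a ≟ w) a≡w)) (m≤m+n _ _)) (m≤n+m _ (ind (adj a w ∧ adj b w)))
      ... | _        | inj₁ b≡w = ≤-trans (≤-trans (1≤ind (dec-true (b ≟ w) b≡w)) (m≤n+m _ (ind (does (a ≟ w))))) (m≤n+m _ (ind (adj a w ∧ adj b w)))
      ... | inj₂ aw  | inj₂ bw  = ≤-trans (1≤ind (∧-true aw bw)) (m≤m+n _ _)

      to-xz : ∀ w → C w ≡ true → D w ≡ true → 1 ≤ ind (adj x w ∧ adj z w)
      to-xz w w∈C w∈D with near-cases (C-clique x∈C w∈C) | near-cases (D-clique z∈D w∈D)
      ... | inj₁ refl | _         = clash (D-clique w∈D z∈D) x≁z
      ... | _         | inj₁ refl = clash (C-clique x∈C w∈C) x≁z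
      ... | inj₂ xw   | inj₂ zw   = 1≤ind (∧-true xw zw)

      split : ∀ w → ind (C w) + ind (D w) ≤
        ind (adj x w ∧ adj z w) + (ind (adj a w ∧ adj b w) + (ind (does (a ≟ w)) + ind (does (b ≟ w))))
      split w with true-or-false (C w) | true-or-false (D w)
      ... | inj₁ w∈C | inj₁ w∈D = +-mono-≤ (≤-trans (ind≤1 (C w)) (to-xz w w∈C w∈D))
                                           (≤-trans (ind≤1 (D w)) (to-ab a∈D b∈D D-clique w w∈D))
      ... | inj₁ w∈C | inj₂ w∉D rewrite w∉D | +-identityʳ (ind (C w)) =
        ≤-trans (ind≤1 (C w)) (≤-trans (to-ab a∈C b∈C C-clique w w∈C) (m≤n+m _ (ind (adj x w ∧ adj z w))))
      ... | inj₂ w∉C | _ rewrite w∉C =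
        ind≤ (D w) (λ w∈D → ≤-trans (to-ab a∈D b∈D D-clique w w∈D) (m≤n+m _ (ind (adj x w ∧ adj z w))))

      total : # C + # D ≤ ℓ + (L + 3)
      total = begin
        # C + # D
          ≡⟨ sym (∑-distrib-+ (ind ∘ C) (ind ∘ D)) ⟩
        sum (λ w → ind (C w) + ind (D w))
          ≤⟨ sum-mono split ⟩
        sum (λ w → f₁ w + (f₂ w + (f₃ w + f₄ w)))
          ≡⟨ ∑-distrib-+ f₁ (λ w → f₂ w + (f₃ w + f₄ w)) ⟩
        sum f₁ + sum (λ w → f₂ w + (f₃ w + f₄ w))
          ≡⟨ cong (sum f₁ +_) (∑-distrib-+ f₂ (λ w → f₃ w + f₄ w)) ⟩
        sum f₁ + (sum f₂ + sum (λ w → f₃ w + f₄ w))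
          ≡⟨ cong (λ t → sum f₁ + (sum f₂ + t)) (∑-distrib-+ f₃ f₄) ⟩
        sum f₁ + (sum f₂ + (sum f₃ + sum f₄))
          ≡⟨ cong₂ _+_ (common-far x z u x≁z xu zu) (cong₂ _+_ (common-near a b ab) (cong₂ _+_ (#-singleton a) (#-singleton b))) ⟩
        suc L + (ℓ + 2)
          ≡⟨ regroup L ℓ ⟩
        ℓ + (L + 3) ∎
        where
        open ≤-Reasoning
        f₁ f₂ f₃ f₄ : Fin v → ℕ
        f₁ w = ind (adj x w ∧ adj z w)
        f₂ w = ind (adj a w ∧ adj b w)
        f₃ w = ind (does (a ≟ w))
        f₄ w = ind (does (b ≟ w))
        regroup : ∀ a b → suc a + (b + 2) ≡ b + (a + 3)
        regroup = solve-∀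

      impossible : ⊥
      impossible = <-irrefl refl (begin-strict
        T′ + T′                           <⟨ +-mono-< C-large D-large ⟩
        (# C + # C) + (# D + # D)         ≡⟨ regroup (# C) (# D) ⟩
        (# C + # D) + (# C + # D)         ≤⟨ +-mono-≤ total total ⟩
        T′ + T′                           ∎)
        where
        open ≤-Reasoning
        T′ = ℓ + (L + 3)
        regroup : ∀ a b → (a + a) + (b + b) ≡ (a + b) + (a + b)
        regroup = solve-∀

  lines-bound : ∀ {N e x z u} → near x z ≡ false → adj x u ≡ true → adj z u ≡ true →
    Lines Γ N e x → Lines Γ N e z → suc L ≤ N * N + (e + e)
  lines-bound {N} {e} {x} {z} {u} x≁z xu zu 𝓒 𝓓 = begin
    suc L
      ≡⟨ sym (common-far x z u x≁z xu zu) ⟩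
    # (λ w → adj x w ∧ adj z w)
      ≤⟨ sum-mono split ⟩
    sum (λ w → sum (λ i → sum (λ j → ind (C i w ∧ D j w))) + (ind (X w) + ind (X′ w)))
      ≡⟨ ∑-distrib-+ (λ w → sum (λ i → sum (λ j → ind (C i w ∧ D j w)))) (λ w → ind (X w) + ind (X′ w)) ⟩
    sum (λ w → sum (λ i → sum (λ j → ind (C i w ∧ D j w)))) + sum (λ w → ind (X w) + ind (X′ w))
      ≡⟨ cong₂ _+_ (trans (∑-comm (λ w i → sum (λ j → ind (C i w ∧ D j w))))
                          (sum-cong-≗ (λ i → ∑-comm (λ w j → ind (C i w ∧ D j w)))))
                   (∑-distrib-+ (ind ∘ X) (ind ∘ X′)) ⟩
    sum (λ i → sum (λ j → # (λ w → C i w ∧ D j w))) + (# X + # X′)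
      ≤⟨ +-mono-≤ pairs (+-mono-≤ (Lines.few 𝓒) (Lines.few 𝓓)) ⟩
    N * N + (e + e) ∎
    where
    open ≤-Reasoning
    C = Lines.line 𝓒
    D = Lines.line 𝓓
    X = Lines.exceptional 𝓒
    X′ = Lines.exceptional 𝓓
    pairs : sum (λ i → sum (λ j → # (λ w → C i w ∧ D j w))) ≤ N * N
    pairs = begin
      sum (λ i → sum (λ j → # (λ w → C i w ∧ D j w)))
        ≤⟨ sum-bounded (Lines.count 𝓓 * 1) (λ i → sum-bounded 1 (λ j →
             line∩line x≁z xu zu (C i) (D j) (Lines.centre 𝓒 i) (Lines.centre 𝓓 j)
               (Lines.clique 𝓒 i) (Lines.clique 𝓓 j) (Lines.large 𝓒 i) (Lines.large 𝓓 j))) ⟩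
      Lines.count 𝓒 * (Lines.count 𝓓 * 1)
        ≡⟨ cong (Lines.count 𝓒 *_) (*-identityʳ _) ⟩
      Lines.count 𝓒 * Lines.count 𝓓
        ≤⟨ *-mono-≤ (Lines.count≤ 𝓒) (Lines.count≤ 𝓓) ⟩
      N * N ∎
    split : ∀ w → ind (adj x w ∧ adj z w) ≤ sum (λ i → sum (λ j → ind (C i w ∧ D j w))) + (ind (X w) + ind (X′ w))
    split w = ind≤ (adj x w ∧ adj z w) (λ h → by-cover (Lines.cover 𝓒 w (∧-conicalˡ _ _ h)) (Lines.cover 𝓓 w (∧-conicalʳ (adj x w) _ h)))
      where
      main = sum (λ i → sum (λ j → ind (C i w ∧ D j w)))
      rest = ind (X w) + ind (X′ w)
      by-cover : (∃ λ i → C i w ≡ true) ⊎ X w ≡ true → (∃ λ j → D j w ≡ true) ⊎ X′ w ≡ true →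
        1 ≤ main + rest
      by-cover (inj₂ h) _ = ≤-trans (≤-trans (1≤ind h) (m≤m+n _ _)) (m≤n+m rest main)
      by-cover _ (inj₂ h) = ≤-trans (≤-trans (1≤ind h) (m≤n+m _ (ind (X w)))) (m≤n+m rest main)
      by-cover (inj₁ (i , w∈C)) (inj₁ (j , w∈D)) = begin
        1                                               ≤⟨ 1≤ind (∧-true w∈C w∈D) ⟩
        ind (C i w ∧ D j w)                             ≤⟨ term≤sum (λ j → ind (C i w ∧ D j w)) j ⟩
        sum (λ j → ind (C i w ∧ D j w))                 ≤⟨ term≤sum (λ i → sum (λ j → ind (C i w ∧ D j w))) i ⟩
        main                                            ≤⟨ m≤m+n main rest ⟩
        main + rest                                     ∎

  open Local Γ using (Coclique; module Maximum)

  -- Two nonadjacent vertices with a common neighbour are found around `o`: for a neighbour `y` of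
  -- `o`, the set `nb y` has only `ℓ + 1 < k` elements, so some neighbour `z` of `o` is outside it.
  -- Lines exist at `y` and `z` up to double negation, which suffices for `⊥`.
  contradiction-from-lines : ∀ {N e} → Fin v → suc ℓ < k →
    k + tri (suc N) * L < suc N * suc ℓ →
    N * N + (e + e) < suc L →
    (∀ x n → n < N → Coclique x (suc n) → ¬ Coclique x (suc (suc n)) → Lines Γ N e x) →
    ⊥
  contradiction-from-lines {N} {e} o ℓ<k claw few-pairs lines-of =
    with-lines y (λ 𝓒 → with-lines z (λ 𝓓 → <⇒≱ few-pairs
      (lines-bound y≁z (trans (adj-sym y o) oy) (trans (adj-sym z o) oz) 𝓒 𝓓)))
    where
    neighbour : ∀ x → ∃ λ w → adj x w ≡ true
    neighbour x = #-nonempty {S = adj x} (subst (0 <_) (sym (degree x)) (<-trans (s≤s z≤n) ℓ<k))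

    y = proj₁ (neighbour o)
    oy = proj₂ (neighbour o)

    far-neighbour : ∃ λ z → ind (Local.nb Γ o y z) < ind (adj o z)
    far-neighbour = sum-<⇒∃ (ind ∘ Local.nb Γ o y) (ind ∘ adj o)
      (subst₂ _<_ (sym (Local.#nb Γ o oy)) (sym (degree o)) ℓ<k)

    z = proj₁ far-neighbour
    oz : adj o z ≡ true
    oz = ind-positive (≤-<-trans z≤n (proj₂ far-neighbour))

    y≁z : near y z ≡ false
    y≁z = Local.∉nb⇒far Γ o oz (ind≡0 (n<1⇒n≡0 (<-≤-trans (proj₂ far-neighbour) (ind≤1 (adj o z)))))

    with-lines : ∀ x → ¬ ¬ Lines Γ N e x
    with-lines x no-lines = Local.maximum-coclique Γ x (suc N)
      (λ Y → <⇒≱ claw (Local.clawBound Γ x Y)) grow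
      where
      grow : ∀ n → n < suc N → Coclique x n → ¬ ¬ Coclique x (suc n)
      grow zero    _         Y none = let w , xw = neighbour x in none (Local.cons Γ x w xw Y (λ ()))
      grow (suc n) (s≤s n<N) Y none = no-lines (lines-of x n n<N Y none)

  -- Every vertex of the neighbourhood is placed on a line, so the exceptional set is empty and any
  -- `e` will do; this lets the result stand beside the lines for `m = 4`.
  generic-lines : ∀ {N e} x n → n < N → L + (n * L + n * L) < suc ℓ →
    Coclique x (suc n) → ¬ Coclique x (suc (suc n)) → Lines Γ N e x
  generic-lines x n n<N star Y maximum = record
    { count       = suc n
    ; count≤      = n<N
    ; line        = M.line
    ; exceptional = const false
    ; centre      = M.line-centre
    ; clique      = λ i → M.line-clique i (≤-<-trans (m≤m+n L (n * L)) (P-large i))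
    ; large       = line-large
    ; few         = ≤-trans (≤-reflexive (sum-replicate-zero v)) z≤n
    ; cover       = λ w xw → let i , h = M.full-somewhere xw (λ i → ≤-<-trans (deg-bound w) (P-large i))
                             in inj₁ (i , ∨-trueʳ (does (x ≟ w)) (∧-true xw h))
    }
    where
    module M = Maximum x Y maximum
    open ≤-Reasoning

    P-large : ∀ i → L + n * L < # (M.P i)
    P-large i = +-cancelʳ-< (n * L) _ _ (begin-strict
      (L + n * L) + n * L   ≡⟨ +-assoc L _ _ ⟩
      L + (n * L + n * L)   <⟨ star ⟩
      suc ℓ                 ≤⟨ M.#P-lower i ⟩
      # (M.P i) + n * L     ∎)

    deg-bound : ∀ w → Local.deg Γ x Y w * L ≤ L + n * L
    deg-bound w = *-monoˡ-≤ L (≤-trans (sum-bounded 1 (λ l → ind≤1 (Local.nb Γ x (M.y l) w))) (≤-reflexive (*-identityʳ (suc n))))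

    line-large : ∀ i → ℓ + (L + 3) < # (M.line i) + # (M.line i)
    line-large i = <-≤-trans (+-cancelʳ-< (n * L + n * L) _ _ (begin-strict
      (ℓ + (L + 3)) + (n * L + n * L)               ≡⟨ regroup ℓ L (n * L) ⟩
      (suc ℓ + 2) + (L + (n * L + n * L))           <⟨ +-monoʳ-< (suc ℓ + 2) star ⟩
      (suc ℓ + 2) + suc ℓ                           ≡⟨ regroup′ (suc ℓ) ⟩
      2 + (suc ℓ + suc ℓ)                           ≤⟨ +-monoʳ-≤ 2 (+-mono-≤ (M.#P-lower i) (M.#P-lower i)) ⟩
      2 + ((p + n * L) + (p + n * L))               ≡⟨ regroup″ p (n * L) ⟩
      (suc p + suc p) + (n * L + n * L)             ∎))
      (+-mono-≤ (M.#P<#line i) (M.#P<#line i))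
      where
      p = # (M.P i)
      regroup : ∀ a b c → (a + (b + 3)) + (c + c) ≡ (suc a + 2) + (b + (c + c))
      regroup = solve-∀
      regroup′ : ∀ a → (a + 2) + a ≡ 2 + (a + a)
      regroup′ = solve-∀
      regroup″ : ∀ p c → 2 + ((p + c) + (p + c)) ≡ (suc p + suc p) + (c + c)
      regroup″ = solve-∀

-- The exceptional case m = n = 4.

-- For m = 4 the cliques P i of a coclique of size 5 may be as small as 246,
-- too small for full-somewhere to place every vertex and for the lines to be
-- large.  The slack in the claw bound is then only 6, so all but 6 vertices
-- lie in at most two of the sets nb (y i), and a line is larger than its P i
-- because few vertices of nb (y i) belong to another line instead.
module m≡4 {v : ℕ} (Γ : CountedGraph v 2046 569 81) (x : Fin v) where
  open CountedGraph Γ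
  open Local Γ x
  open Coclique

  module _ (Y : Coclique 5) (maximum : ¬ Coclique 6) where
    open Maximum Y maximum

    #P≥246 : ∀ i → 246 ≤ # (P i)
    #P≥246 i = +-cancelʳ-≤ 324 246 (# (P i)) (#P-lower i)

    -- The other four closed neighbourhoods cover at least 4 · 570 - 6 · 81 = 1794 of the 2046
    -- vertices, and `P i` is disjoint from them.
    #P≤252 : ∀ i → # (P i) ≤ 252
    #P≤252 i = +-cancelʳ-≤ 1794 (# (P i)) 252 (begin
      # (P i) + 1794
        ≤⟨ +-monoʳ-≤ (# (P i)) (+-cancelʳ-≤ 486 1794 _ (#union R)) ⟩
      # (P i) + # (not ∘ out R)
        ≡⟨ sym (∑-distrib-+ (ind ∘ P i) (ind ∘ not ∘ out R)) ⟩
      sum (λ w → ind (P i w) + ind (not (out R w)))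
        ≤⟨ sum-mono split ⟩
      # (adj x)
        ≡⟨ degree x ⟩
      2046 ∎)
      where
      open ≤-Reasoning
      R = remove i Y
      P⇒out : ∀ w → P i w ≡ true → out R w ≡ true
      P⇒out w h = cong (_≡ᵇ 0) (ℕ.suc-injective (trans (sym
        (trans (deg-remove Y i w) (cong (λ b → ind b + deg R w) (P⊆nb i h)))) (P-deg i h)))
      split : ∀ w → ind (P i w) + ind (not (out R w)) ≤ ind (adj x w)
      split w with true-or-false (P i w)
      ... | inj₁ h rewrite h | P⇒out w h | P⊆Δ i h = ≤-refl
      ... | inj₂ h rewrite h = ind≤ (not (out R w)) (λ e → 1≤ind (not-out⇒adj R w e))

    X : V → Bool
    X w = 3 ≤ᵇ deg Y w

    -- A vertex in d ≥ 3 of the sets gives away `tri d + 1 - d ≥ 1` in the second Bonferroni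
    -- inequality, whose total slack is 2046 + 10 · 81 - 5 · 570 = 6.
    #X≤6 : # X ≤ 6
    #X≤6 = +-cancelˡ-≤ 2850 (# X) 6 (begin
      2850 + # X                ≤⟨ bonferroni Y (ind ∘ X) (ind ∘ adj x) split ⟩
      # (adj x) + 810           ≡⟨ cong (_+ 810) (degree x) ⟩
      2856                      ∎)
      where
      open ≤-Reasoning
      split : ∀ w → deg Y w + ind (X w) ≤ ind (adj x w) + tri (deg Y w)
      split w with deg Y w | deg≤adj+tri Y w | deg-positive Y w
      ... | zero              | _ | _ = z≤n
      ... | suc zero          | h | _ = h
      ... | suc (suc zero)    | h | _ = h
      ... | suc (suc (suc d)) | _ | positive
        with l , e ← positive (s≤s z≤n) rewrite nb-adj {y l} {w} e =
        s≤s (s≤s (s≤s (+-monoʳ-≤ d (s≤s z≤n))))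

    module _ (i : Fin 5) (j′ : Fin 4) where
      j : Fin 5
      j = punchIn i j′

      i≢j : i ≢ j
      i≢j = punchInᵢ≢i i j′ ∘ sym

      R : Coclique 3
      R = remove j′ (remove i Y)

      -- The vertices of `nb (y i)` that line `i` loses to line `j`. In degree 2 they lie in
      -- `nb (y i)` and `nb (y j)` and in no other of the five sets.
      B : V → Bool
      B w = (full j w ∧ not (full i w)) ∧ (nb (y i) w ∧ (deg Y w ≡ᵇ 2))

      B-full : ∀ w → B w ≡ true → full j w ≡ true
      B-full w h = ∧-conicalˡ _ _ (∧-conicalˡ _ _ h)

      B-not-full : ∀ w → B w ≡ true → full i w ≡ false
      B-not-full w h = not-true (∧-conicalʳ (full j w) _ (∧-conicalˡ _ _ h))
        where
        not-true : ∀ {b} → not b ≡ true → b ≡ false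
        not-true {false} _ = refl

      B-nb : ∀ w → B w ≡ true → nb (y i) w ≡ true
      B-nb w h = ∧-conicalˡ _ _ (∧-conicalʳ (full j w ∧ not (full i w)) _ h)

      Q : V → Bool
      Q w = nb (y i) w ∧ nb (y j) w

      B⊆Q : ∀ w → B w ≡ true → Q w ≡ true
      B⊆Q w h = ∧-true (B-nb w h) (full⇒nb j (nb-adj {y i} {w} (B-nb w h)) (B-full w h))

      #Q≤81 : # Q ≤ 81
      #Q≤81 = #nb∩nb (inside Y i) (inside Y j) (indep Y i≢j)

      #Q∖B : # (λ w → Q w ∧ not (B w)) + # B ≤ 81
      #Q∖B = begin
        # (λ w → Q w ∧ not (B w)) + # B
          ≡⟨ sym (∑-distrib-+ (λ w → ind (Q w ∧ not (B w))) (ind ∘ B)) ⟩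
        sum (λ w → ind (Q w ∧ not (B w)) + ind (B w))
          ≤⟨ sum-mono split ⟩
        # Q
          ≤⟨ #Q≤81 ⟩
        81 ∎
        where
        open ≤-Reasoning
        split : ∀ w → ind (Q w ∧ not (B w)) + ind (B w) ≤ ind (Q w)
        split w with true-or-false (B w)
        ... | inj₁ h rewrite h | B⊆Q w h = ≤-refl
        ... | inj₂ h rewrite h | +-identityʳ (ind (Q w ∧ true)) =
          ind≤ (Q w ∧ true) (λ e → 1≤ind (∧-conicalˡ _ _ e))

      M : V → V → Bool
      M u w = out R w ∧ (nb u w ∧ nb (y j) w)

      -- Both `u` and `y j` are far from the three members of `R`, so 5 · 570 is at most 2046 plus
      -- the overlap plus 9 · 81.
      #M≥75 : ∀ u → P i u ≡ true → 75 ≤ # (M u)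
      #M≥75 u h = +-cancelˡ-≤ 2046 75 (# (M u)) (+-cancelʳ-≤ 729 2121 _
        (#common-out R u (y j) (P⊆Δ i h) (inside Y j)
          (λ l → far-sym (P-far i h (punchInᵢ≢i i (punchIn j′ l))))
          (λ l → indep Y (λ e → punchInᵢ≢i j′ l (sym (punchIn-injective i _ _ e))))))

      H : V → ℕ
      H w = # (λ u → P i u ∧ M u w)

      H≤#P : ∀ w → H w ≤ # (P i)
      H≤#P w = #-mono {S = λ u → P i u ∧ M u w} {T = P i} (λ u → ∧-conicalˡ _ _)

      M⇒nb : ∀ u w → P i u ≡ true → M u w ≡ true → nb w u ≡ true
      M⇒nb u w u∈P h = nb-intro (P⊆Δ i u∈P)
        (trans (near-sym w u) (nb-near {u} {w} (∧-conicalˡ _ _ (∧-conicalʳ (out R w) _ h))))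

      H-not-full : ∀ w → adj x w ≡ true → full i w ≡ false → H w ≤ 81
      H-not-full w xw h =
        let p , p∈P , w≁p = not-full i h in
        ≤-trans (#-mono {S = λ u → P i u ∧ M u w} {T = λ u → P i u ∧ nb w u}
                  (λ u e → let u∈P = ∧-conicalˡ (P i u) _ e in
                           ∧-true u∈P (M⇒nb u w u∈P (∧-conicalʳ (P i u) _ e))))
                (#P∩nb i xw p∈P w≁p)

      -- The vertices counted by `H w` and those of `B` all lie in `nb (y i)` and `nb w`: those of
      -- `B` are near `w` because they are full on `P j`. The two sets are disjoint, since `P i` is
      -- full on itself and `B` avoids such vertices.
      H-private : ∀ w → P j w ≡ true → H w + # B ≤ 81
      H-private w w∈P = begin
        H w + # B
          ≡⟨ sym (∑-distrib-+ (λ u → ind (P i u ∧ M u w)) (ind ∘ B)) ⟩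
        sum (λ u → ind (P i u ∧ M u w) + ind (B u))
          ≤⟨ sum-mono split ⟩
        # (λ u → nb (y i) u ∧ nb w u)
          ≤⟨ #nb∩nb (inside Y i) (P⊆Δ j w∈P) (P-far j w∈P i≢j) ⟩
        81 ∎
        where
        open ≤-Reasoning
        split : ∀ u → ind (P i u ∧ M u w) + ind (B u) ≤ ind (nb (y i) u ∧ nb w u)
        split u with true-or-false (B u)
        ... | inj₁ h with true-or-false (P i u)
        ...   | inj₁ u∈P = clash (P⊆full i u∈P) (B-not-full u h)
        ...   | inj₂ u∉P rewrite u∉P = ≤-trans (ind≤1 (B u)) (1≤ind (∧-true (B-nb u h)
          (nb-intro (nb-adj {y i} {u} (B-nb u h)) (trans (near-sym w u) (full-near j (B-full u h) w∈P)))))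
        split u | inj₂ h rewrite h | +-identityʳ (ind (P i u ∧ M u w)) =
          ind≤ (P i u ∧ M u w) (λ e → let u∈P = ∧-conicalˡ (P i u) _ e in
            1≤ind (∧-true (P⊆nb i u∈P) (M⇒nb u w u∈P (∧-conicalʳ (P i u) _ e))))

      -- The edges between P i and the vertices of nb (y j) outside the other
      -- nb (y l) number at least 75 per vertex of P i, while a large B leaves
      -- few neighbours in P i for the vertices of P j and of Q ∖ B.
      #B≤59 : # B ≤ 59
      #B≤59 = ≮⇒≥ (λ 60≤#B → <⇒≱
        (numeric (#P≥246 i) (#P≤252 j) (≤-trans (m≤n+m (# B) _) #Q∖B) (at-most-21 60≤#B #Q∖B))
        (bound 60≤#B))
        where
        open ≤-Reasoning
        p = # (P i)

        numeric : ∀ {p a b c} → 246 ≤ p → a ≤ 252 → b ≤ 81 → c ≤ 21 → a * 21 + (b * 81 + c * p) < p * 75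
        numeric {p} {a} {b} {c} p≥ a≤ b≤ c≤ = begin-strict
          a * 21 + (b * 81 + c * p)      ≡⟨ sym (+-assoc (a * 21) (b * 81) (c * p)) ⟩
          (a * 21 + b * 81) + c * p      <⟨ +-mono-<-≤ small (≤-trans (*-monoˡ-≤ p c≤) (≤-reflexive (*-comm 21 p))) ⟩
          p * 54 + p * 21                ≡⟨ sym (*-distribˡ-+ p 54 21) ⟩
          p * 75                         ∎
          where
          small : a * 21 + b * 81 < p * 54
          -- 252 · 21 + 81 · 81 = 11853 and 54 · 246 = 13284; the literal 11854 accounts for
          -- strictness.
          small = <-≤-trans (≤-<-trans (+-mono-≤ (*-monoˡ-≤ 21 a≤) (*-monoˡ-≤ 81 b≤)) (≤ᵇ⇒≤ 11854 13284 _))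
                            (*-monoˡ-≤ 54 p≥)

        module _ (60≤#B : 60 ≤ # B) where
          at-most-21 : ∀ {a} → a + # B ≤ 81 → a ≤ 21
          at-most-21 {a} h = +-cancelʳ-≤ 60 a 21 (≤-trans (+-monoʳ-≤ a 60≤#B) h)

          -- If `H w` is nonzero, `w` is in `nb (y j)` and outside the sets of `R`. So it is private
          -- to `y j`, or it lies in `Q` and is then sorted by membership in `B`.
          split : ∀ w → H w ≤ ind (P j w) * 21 + (ind (B w) * 81 + ind (Q w ∧ not (B w)) * p)
          split w with H w ℕ.≟ 0
          ... | yes e = ≤-trans (≤-reflexive e) z≤n
          ... | no  H≢0 with u , h ← #-nonempty {S = λ u → P i u ∧ M u w} (n≢0⇒n>0 H≢0)
            with w∈out ← ∧-conicalˡ (out R w) _ (∧-conicalʳ (P i u) _ h)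
               | w∈nbⱼ ← ∧-conicalʳ (nb u w) _ (∧-conicalʳ (out R w) _ (∧-conicalʳ (P i u) _ h))
            with true-or-false (nb (y i) w)
          ... | inj₂ w∉nbᵢ = ≤-trans (at-most-21 (H-private w w∈P))
            (≤-trans (≤ind* 21 w∈P) (m≤m+n (ind (P j w) * 21) _))
            where
            deg≡1 : deg Y w ≡ 1
            deg≡1 = trans (deg-remove Y i w) (cong₂ _+_ (cong ind w∉nbᵢ)
              (trans (deg-remove (remove i Y) j′ w)
                (cong₂ _+_ (cong ind w∈nbⱼ) (≡ᵇ⇒≡ _ 0 (subst T (sym w∈out) _)))))
            w∈P : P j w ≡ true
            w∈P = ∧-true w∈nbⱼ (cong (_≡ᵇ 1) deg≡1)
          ... | inj₁ w∈nbᵢ with true-or-false (B w)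
          ...   | inj₁ w∈B =
            ≤-trans (H-not-full w (nb-adj {y i} {w} w∈nbᵢ) (B-not-full w w∈B))
              (≤-trans (≤ind* 81 w∈B) (≤-trans (m≤m+n (ind (B w) * 81) _) (m≤n+m _ (ind (P j w) * 21))))
          ...   | inj₂ w∉B =
            ≤-trans (H≤#P w) (≤-trans (≤ind* p (∧-true (∧-true w∈nbᵢ w∈nbⱼ) (cong not w∉B)))
              (≤-trans (m≤n+m _ (ind (B w) * 81)) (m≤n+m _ (ind (P j w) * 21))))

          bound : p * 75 ≤ # (P j) * 21 + (# B * 81 + # (λ w → Q w ∧ not (B w)) * p)
          bound = begin
            p * 75
              ≡⟨ sym (sum-ind-* (P i) 75) ⟩
            sum (λ u → ind (P i u) * 75)
              ≤⟨ sum-mono lower ⟩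
            sum (λ u → # (λ w → P i u ∧ M u w))
              ≡⟨ ∑-comm (λ u w → ind (P i u ∧ M u w)) ⟩
            sum H
              ≤⟨ sum-mono split ⟩
            sum (λ w → f₁ w + (f₂ w + f₃ w))
              ≡⟨ trans (∑-distrib-+ f₁ (λ w → f₂ w + f₃ w)) (cong (sum f₁ +_) (∑-distrib-+ f₂ f₃)) ⟩
            sum f₁ + (sum f₂ + sum f₃)
              ≡⟨ cong₂ _+_ (sum-ind-* (P j) 21) (cong₂ _+_ (sum-ind-* B 81) (sum-ind-* (λ w → Q w ∧ not (B w)) p)) ⟩
            # (P j) * 21 + (# B * 81 + # (λ w → Q w ∧ not (B w)) * p) ∎
            where
            f₁ f₂ f₃ : V → ℕ
            f₁ w = ind (P j w) * 21
            f₂ w = ind (B w) * 81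
            f₃ w = ind (Q w ∧ not (B w)) * p
            lower : ∀ u → ind (P i u) * 75 ≤ # (λ w → P i u ∧ M u w)
            lower u with true-or-false (P i u)
            ... | inj₁ h rewrite h = #M≥75 u h
            ... | inj₂ h rewrite h = z≤n

    two-full : ∀ w → adj x w ≡ true → deg Y w ≤ 2 → ∃ λ i → full i w ≡ true
    two-full w xw h = full-somewhere xw (λ i →
      ≤-<-trans (*-monoˡ-≤ 81 h) (<-≤-trans (≤ᵇ⇒≤ 163 246 _) (#P≥246 i)))

    not-X : ∀ w → X w ≡ false → deg Y w ≤ 2
    not-X w h with deg Y w
    ... | zero              = z≤n
    ... | suc zero          = s≤s z≤n
    ... | suc (suc zero)    = ≤-refl

    -- A vertex of `nb (y i)` off line `i` is in `X`, or it has degree at most 2, is full elsewhere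
    -- and so belongs to some `B i j′`. This leaves 571 - 6 - 4 · 59 = 329. A line needs 327
    -- vertices, because twice its size must exceed 569 + 84 = 653; with 60 in place of 59 only 325
    -- would remain.
    #line≥329 : ∀ i → 329 ≤ # (line i)
    #line≥329 i = +-cancelʳ-≤ 242 329 (# (line i)) (begin
      1 + 570
        ≡⟨ cong₂ _+_ (sym (#-singleton x)) (sym (#nb (inside Y i))) ⟩
      # (λ w → does (x ≟ w)) + # (nb (y i))
        ≡⟨ sym (∑-distrib-+ (λ w → ind (does (x ≟ w))) (ind ∘ nb (y i))) ⟩
      sum (λ w → ind (does (x ≟ w)) + ind (nb (y i) w))
        ≤⟨ sum-mono split ⟩
      sum (λ w → ind (line i w) + (ind (X w) + sum (λ j′ → ind (B i j′ w))))
        ≡⟨ trans (∑-distrib-+ (ind ∘ line i) (λ w → ind (X w) + sum (λ j′ → ind (B i j′ w))))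
             (cong (# (line i) +_) (trans (∑-distrib-+ (ind ∘ X) (λ w → sum (λ j′ → ind (B i j′ w))))
               (cong (# X +_) (∑-comm (λ w j′ → ind (B i j′ w)))))) ⟩
      # (line i) + (# X + sum (λ j′ → # (B i j′)))
        ≤⟨ +-monoʳ-≤ (# (line i)) (+-mono-≤ #X≤6 (sum-bounded 59 (#B≤59 i))) ⟩
      # (line i) + 242 ∎)
      where
      open ≤-Reasoning
      split : ∀ w → ind (does (x ≟ w)) + ind (nb (y i) w) ≤
              ind (line i w) + (ind (X w) + sum (λ j′ → ind (B i j′ w)))
      split w with x ≟ w
      ... | yes refl rewrite adj-irrefl x = s≤s z≤n
      ... | no  _    = ind≤ (nb (y i) w) covered
        where
        covered : nb (y i) w ≡ true → 1 ≤ ind (adj x w ∧ full i w) + (ind (X w) + sum (λ j′ → ind (B i j′ w)))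
        covered e with true-or-false (full i w) | true-or-false (X w)
        ... | inj₁ h | _ = ≤-trans (1≤ind (∧-true (nb-adj {y i} {w} e) h)) (m≤m+n _ _)
        ... | inj₂ _ | inj₁ h = ≤-trans (1≤ind h) (≤-trans (m≤m+n _ _) (m≤n+m _ (ind (adj x w ∧ full i w))))
        ... | inj₂ ¬full | inj₂ ¬X
          with l , l-full ← two-full w (nb-adj {y i} {w} e) (not-X w ¬X)
          with i ≟ l
        ...   | yes refl = clash l-full ¬full
        ...   | no  i≢l  = begin
          1                              ≤⟨ 1≤ind w∈B ⟩
          ind (B i (punchOut i≢l) w)     ≤⟨ term≤sum (λ j′ → ind (B i j′ w)) (punchOut i≢l) ⟩
          sum (λ j′ → ind (B i j′ w))    ≤⟨ m≤n+m _ (ind (X w)) ⟩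
          ind (X w) + sum (λ j′ → ind (B i j′ w)) ≤⟨ m≤n+m _ (ind (adj x w ∧ full i w)) ⟩
          _                              ∎
          where
          2≤deg : 2 ≤ deg Y w
          2≤deg = ≤-trans (+-mono-≤ (1≤ind e) (1≤ind (full⇒nb l (nb-adj {y i} {w} e) l-full)))
            (two-terms≤sum (λ t → ind (nb (y t) w)) i≢l)
          w∈B : B i (punchOut i≢l) w ≡ true
          w∈B = ∧-true (∧-true (trans (cong (λ t → full t w) (punchIn-punchOut i≢l)) l-full) (cong not ¬full))
            (∧-true e (cong (_≡ᵇ 2) (≤-antisym (not-X w ¬X) 2≤deg)))

    lines : Lines Γ 5 6 x
    lines = record
      { count       = 5
      ; count≤      = ≤-refl
      ; line        = line
      ; exceptional = X
      ; centre      = line-centre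
      ; clique      = λ i → line-clique i (<-≤-trans (≤ᵇ⇒≤ 82 246 _) (#P≥246 i))
      ; large       = λ i → <-≤-trans (≤ᵇ⇒≤ 654 658 _) (+-mono-≤ (#line≥329 i) (#line≥329 i))
      ; few         = #X≤6
      ; cover       = covered
      }
      where
      covered : ∀ w → adj x w ≡ true → (∃ λ i → line i w ≡ true) ⊎ X w ≡ true
      covered w xw with true-or-false (X w)
      ... | inj₁ h = inj₂ h
      ... | inj₂ h with i , e ← two-full w xw (not-X w h) = inj₁ (i , ∨-trueʳ (does (x ≟ w)) (∧-true xw e))

-- Clearing denominators and polynomial inequalities.

half-equation : ∀ a b c → pos a / 1 ≃ (pos b) / 2 +ᵘ (pos c) / 1 → 2 * a ≡ b + 2 * c
half-equation a b c (*≡* e) = ℤ.+-injective (begin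
  pos (2 * a)                               ≡⟨ ℤ.pos-* 2 a ⟩
  pos 2 ℤ.* pos a                             ≡⟨ ℤ.*-comm (pos 2) (pos a) ⟩
  pos a ℤ.* pos 2                             ≡⟨ e ⟩
  (pos b ℤ.* pos 1 ℤ.+ pos c ℤ.* pos 2) ℤ.* pos 1   ≡⟨ ring (pos b) (pos c) ⟩
  pos b ℤ.+ pos 2 ℤ.* pos c                     ≡⟨ cong (ℤ._+_ (pos b)) (sym (ℤ.pos-* 2 c)) ⟩
  pos (b + 2 * c)                           ∎)
  where
  open ≡-Reasoning
  ring : ∀ b c → (b ℤ.* pos 1 ℤ.+ c ℤ.* pos 2) ℤ.* pos 1 ≡ b ℤ.+ pos 2 ℤ.* c
  ring = ℤSolver.solve-∀

valency-equation : ∀ m k μ lam →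
  pos k / 1 ≃ (pos (m + 1) ℤ.* (pos m ℤ.* (pos 2 ℤ.- pos μ) ℤ.+ pos 2 ℤ.* pos lam)) / 2 +ᵘ 1ℚᵘ →
  2 * k + (m + 1) * (m * μ) ≡ (m + 1) * (m * 2 + 2 * lam) + 2
valency-equation m k μ lam (*≡* e) = ℤ.+-injective (begin
  pos (2 * k + (m + 1) * (m * μ))
    ≡⟨ cong₂ ℤ._+_ (ℤ.pos-* 2 k) (trans (ℤ.pos-* (m + 1) (m * μ)) (cong (pos (m + 1) ℤ.*_) (ℤ.pos-* m μ))) ⟩
  pos 2 ℤ.* pos k ℤ.+ pos (m + 1) ℤ.* (pos m ℤ.* pos μ)
    ≡⟨ cong (ℤ._+ pos (m + 1) ℤ.* (pos m ℤ.* pos μ)) (trans (ℤ.*-comm (pos 2) (pos k)) e) ⟩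
  (pos (m + 1) ℤ.* (pos m ℤ.* (pos 2 ℤ.- pos μ) ℤ.+ pos 2 ℤ.* pos lam) ℤ.* pos 1 ℤ.+ pos 1 ℤ.* pos 2) ℤ.* pos 1 ℤ.+ pos (m + 1) ℤ.* (pos m ℤ.* pos μ)
    ≡⟨ ring (pos (m + 1)) (pos m) (pos μ) (pos lam) ⟩
  pos (m + 1) ℤ.* (pos m ℤ.* pos 2 ℤ.+ pos 2 ℤ.* pos lam) ℤ.+ pos 2
    ≡⟨ cong (ℤ._+ pos 2) (sym (trans (ℤ.pos-* (m + 1) (m * 2 + 2 * lam))
         (cong (pos (m + 1) ℤ.*_) (cong₂ ℤ._+_ (ℤ.pos-* m 2) (ℤ.pos-* 2 lam))))) ⟩
  pos ((m + 1) * (m * 2 + 2 * lam) + 2) ∎)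
  where
  open ≡-Reasoning
  ring : ∀ a m μ l → (a ℤ.* (m ℤ.* (pos 2 ℤ.- μ) ℤ.+ pos 2 ℤ.* l) ℤ.* pos 1 ℤ.+ pos 1 ℤ.* pos 2) ℤ.* pos 1 ℤ.+ a ℤ.* (m ℤ.* μ)
    ≡ a ℤ.* (m ℤ.* pos 2 ℤ.+ pos 2 ℤ.* l) ℤ.+ pos 2
  ring = ℤSolver.solve-∀

-- The graph without vertices meets all regularity conditions vacuously. It is excluded because the
-- formula for `v` has a positive value once λ + 1 < k.
order-positive : ∀ {k lam L} → suc lam < k →
  pos 0 / 1 ≃ 1ℚᵘ +ᵘ pos k / 1 +ᵘ (pos k ℤ.* (pos k ℤ.- pos lam ℤ.- pos 1)) / suc L → ⊥
order-positive {k} {lam} {L} lam<k (*≡* e) with j , refl ← ℕ.m≤n⇒∃[o]m+o≡n lam<k = zero≢suc (ℤ.+-injective (begin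
  pos 0
    ≡⟨ e ⟩
  ((pos 1 ℤ.* pos 1 ℤ.+ pos k ℤ.* pos 1) ℤ.* pos (suc L) ℤ.+ pos k ℤ.* (pos k ℤ.- pos lam ℤ.- pos 1) ℤ.* pos 1) ℤ.* pos 1
    ≡⟨ ring (pos lam) (pos j) (pos (suc L)) ⟩
  (pos 1 ℤ.+ pos k) ℤ.* pos (suc L) ℤ.+ pos k ℤ.* (pos 1 ℤ.+ pos j)
    ≡⟨ sym (cong₂ ℤ._+_ (ℤ.pos-* (suc k) (suc L)) (ℤ.pos-* k (suc j))) ⟩
  pos (suc k * suc L + k * suc j) ∎))
  where
  open ≡-Reasoning
  zero≢suc : ∀ {n} → 0 ≢ suc n
  zero≢suc ()
  ring : ∀ l j M → let k = pos 2 ℤ.+ (l ℤ.+ j) in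
    ((pos 1 ℤ.* pos 1 ℤ.+ k ℤ.* pos 1) ℤ.* M ℤ.+ k ℤ.* (k ℤ.- l ℤ.- pos 1) ℤ.* pos 1) ℤ.* pos 1
    ≡ (pos 1 ℤ.+ k) ℤ.* M ℤ.+ k ℤ.* (pos 1 ℤ.+ j)
  ring = ℤSolver.solve-∀

2*tri : ∀ n → 2 * tri (suc n) ≡ suc n * n
2*tri zero    = refl
2*tri (suc n) = trans (*-distribˡ-+ 2 (suc n) (tri (suc n)))
  (trans (cong (2 * suc n +_) (2*tri n)) (ring n))
  where
  ring : ∀ n → 2 * suc n + suc n * n ≡ suc (suc n) * suc n
  ring = solve-∀

-- The parameters as polynomials in s = m - 4, with L = μ - 1.
L-poly 2ℓ-poly 2k-poly : ℕ → ℕ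
L-poly  s = ((s + 13) * s + 56) * s + 81
2ℓ-poly s = ((((s + 20) * s + 161) * s + 656) * s + 1356) * s + 1138
2k-poly s = (((((s + 24) * s + 239) * s + 1268) * s + 3792) * s + 6078) * s + 4092

module Numbers (s : ℕ) {k ℓ L : ℕ} (eL : L ≡ L-poly s) (eℓ : 2 * ℓ ≡ 2ℓ-poly s) (ek : 2 * k ≡ 2k-poly s) where

  -- λ and k are known only through their doubles, which have integer coefficients. The witness `d`
  -- is always a polynomial with nonnegative coefficients, so the inequality reduces to a ring
  -- identity.
  <-by-doubles : ∀ {a b a′ b′} d → 2 * a ≡ a′ → 2 * b ≡ b′ → b′ ≡ suc (a′ + d) → a < b
  <-by-doubles {a} {b} d refl refl e = *-cancelˡ-< 2 a b (subst (2 * a <_) (sym e) (s≤s (m≤m+n (2 * a) d)))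

  ℓ<k : suc ℓ < k
  ℓ<k = <-by-doubles ((((((s + 23) * s + 219) * s + 1107) * s + 3136) * s + 4722) * s + 2951) (trans (*-suc 2 ℓ) (cong (2 +_) eℓ)) ek (ring s)
    where
    ring : ∀ s → let
        2ℓ = ((((s + 20) * s + 161) * s + 656) * s + 1356) * s + 1138
        2k = (((((s + 24) * s + 239) * s + 1268) * s + 3792) * s + 6078) * s + 4092
      in 2k ≡ suc (2 + 2ℓ + ((((((s + 23) * s + 219) * s + 1107) * s + 3136) * s + 4722) * s + 2951))
    ring = solve-∀

  claw : k + tri (6 + s) * L < (6 + s) * suc ℓ
  claw = <-by-doubles (((((s + 18) * s + 125) * s + 413) * s + 627) * s + 317) left right (ring s)
    where
    left : 2 * (k + tri (6 + s) * L) ≡ 2k-poly s + (6 + s) * (5 + s) * L-poly s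
    left = trans (*-distribˡ-+ 2 k _) (cong₂ _+_ ek
      (trans (sym (*-assoc 2 (tri (6 + s)) L)) (cong₂ _*_ (2*tri (5 + s)) eL)))
    right : 2 * ((6 + s) * suc ℓ) ≡ (6 + s) * (2 + 2ℓ-poly s)
    right = trans (sym (*-assoc 2 (6 + s) (suc ℓ))) (trans (cong (_* suc ℓ) (*-comm 2 (6 + s)))
      (trans (*-assoc (6 + s) 2 (suc ℓ)) (cong ((6 + s) *_) (trans (*-suc 2 ℓ) (cong (2 +_) eℓ)))))
    ring : ∀ s → let
        L = ((s + 13) * s + 56) * s + 81
        2ℓ = ((((s + 20) * s + 161) * s + 656) * s + 1356) * s + 1138
        2k = (((((s + 24) * s + 239) * s + 1268) * s + 3792) * s + 6078) * s + 4092
      in (6 + s) * (2 + 2ℓ) ≡ suc (2k + (6 + s) * (5 + s) * L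
        + (((((s + 18) * s + 125) * s + 413) * s + 627) * s + 317))
    ring = solve-∀

  -- The 12 allows for 6 exceptional vertices at each of two centres, as `m = 4` requires; there is
  -- room for it at every `m`.
  few-pairs : (5 + s) * (5 + s) + 12 < suc L
  few-pairs = subst (λ L → (5 + s) * (5 + s) + 12 < suc L) (sym (trans eL (ring s))) (s≤s (m≤m+n _ _))
    where
    ring : ∀ s → let
        L = ((s + 13) * s + 56) * s + 81
      in L ≡ (5 + s) * (5 + s) + 12 + (((s + 12) * s + 46) * s + 44)
    ring = solve-∀

  star-by-doubles : ∀ n p → 2 + 2ℓ-poly s ≡ suc (2 * (L-poly s + (n * L-poly s + n * L-poly s)) + p) →
    L + (n * L + n * L) < suc ℓ
  star-by-doubles n p e = <-by-doubles p (cong (λ L → 2 * (L + (n * L + n * L))) eL)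
    (trans (*-suc 2 ℓ) (cong (2 +_) eℓ)) e

  -- This is the case n = m - 1, which settles all cocliques of at most m vertices. It is tight for
  -- `m = 4`, where it reads 567 < 570.
  star : L + ((3 + s) * L + (3 + s) * L) < suc ℓ
  star = star-by-doubles (3 + s) (((((s + 16) * s + 95) * s + 250) * s + 248) * s + 5) (ring s)
    where
    ring : ∀ s → let
        L = ((s + 13) * s + 56) * s + 81
        2ℓ = ((((s + 20) * s + 161) * s + 656) * s + 1356) * s + 1138
      in 2 + 2ℓ ≡ suc (2 * (L + ((3 + s) * L + (3 + s) * L))
        + (((((s + 16) * s + 95) * s + 250) * s + 248) * s + 5))
    ring = solve-∀

-- The case n = m of cocliques of the full size m + 1, written in r = m - 5 because it needs m ≥ 5.
star⁺ : ∀ {r k ℓ L} → L ≡ L-poly (suc r) → 2 * ℓ ≡ 2ℓ-poly (suc r) → 2 * k ≡ 2k-poly (suc r) →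
  L + ((5 + r) * L + (5 + r) * L) < suc ℓ
star⁺ {r} {k} eL eℓ ek = Numbers.star-by-doubles (suc r) {k} eL eℓ ek (5 + r) (((((r + 21) * r + 165) * r + 577) * r + 762) * r + 11) (ring r)
  where
  ring : ∀ s → let
      t = suc s
      L = ((t + 13) * t + 56) * t + 81
      2ℓ = ((((t + 20) * t + 161) * t + 656) * t + 1356) * t + 1138
    in 2 + 2ℓ ≡ suc (2 * (L + ((5 + s) * L + (5 + s) * L))
      + (((((s + 21) * s + 165) * s + 577) * s + 762) * s + 11))
  ring = solve-∀

module _ {s v k lam μ : ℕ} (par : Parameters (4 + s) v k lam μ) where
  open Parameters par

  μ≡ : μ ≡ suc (L-poly s)
  μ≡ = trans μ-formula (ring s)
    where
    ring : ∀ s → let u = suc s in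
      u * (u * (u * 1)) + 10 * (u * (u * 1)) + 33 * u + 38 ≡ suc (((s + 13) * s + 56) * s + 81)
    ring = solve-∀

  2λ≡ : 2 * lam ≡ 2ℓ-poly s
  2λ≡ = trans (half-equation lam (t ^ 5 + 15 * t ^ 4 + 91 * t ^ 3 + 283 * t ^ 2) (226 * t + 148) λ-formula) (ring s)
    where
    ring : ∀ s → let u = suc s; u² = u * (u * 1) in
      u * (u * (u * u²)) + 15 * (u * (u * u²)) + 91 * (u * u²) + 283 * u² + 2 * (226 * u + 148)
      ≡ ((((s + 20) * s + 161) * s + 656) * s + 1356) * s + 1138
    ring = solve-∀

  2k≡ : 2 * k ≡ 2k-poly s
  2k≡ = +-cancelʳ-≡ ((4 + s + 1) * ((4 + s) * μ)) (2 * k) (2k-poly s) (begin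
    2 * k + (4 + s + 1) * ((4 + s) * μ)
      ≡⟨ valency-equation (4 + s) k μ lam k-formula ⟩
    (4 + s + 1) * ((4 + s) * 2 + 2 * lam) + 2
      ≡⟨ cong (λ t → (4 + s + 1) * ((4 + s) * 2 + t) + 2) 2λ≡ ⟩
    (4 + s + 1) * ((4 + s) * 2 + 2ℓ-poly s) + 2
      ≡⟨ ring s ⟩
    2k-poly s + (4 + s + 1) * ((4 + s) * suc (L-poly s))
      ≡⟨ cong (λ t → 2k-poly s + (4 + s + 1) * ((4 + s) * t)) (sym μ≡) ⟩
    2k-poly s + (4 + s + 1) * ((4 + s) * μ) ∎)
    where
    open ≡-Reasoning
    ring : ∀ s → let
        L = ((s + 13) * s + 56) * s + 81
        2ℓ = ((((s + 20) * s + 161) * s + 656) * s + 1356) * s + 1138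
        2k = (((((s + 24) * s + 239) * s + 1268) * s + 3792) * s + 6078) * s + 4092
      in (4 + s + 1) * ((4 + s) * 2 + 2ℓ) + 2 ≡ 2k + (4 + s + 1) * ((4 + s) * suc L)
    ring = solve-∀

-- Translation of the given graph and the final case distinction.

size-tabulate : ∀ {n} (f : Fin n → Bool) → ∣ tabulate f ∣ ≡ # f
size-tabulate {zero}  f = refl
size-tabulate {suc n} f with f zero
... | true  = cong suc (size-tabulate (f ∘ suc))
... | false = size-tabulate (f ∘ suc)

∩-tabulate : ∀ {n} (f g : Fin n → Bool) → tabulate f ∩ tabulate g ≡ tabulate (λ i → f i ∧ g i)
∩-tabulate {zero}  f g = refl
∩-tabulate {suc n} f g = cong (f zero ∧ g zero ∷ᵥ_) (∩-tabulate (f ∘ suc) (g ∘ suc))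

module _ {v k lam L : ℕ} (G : Graph v) (srg : StronglyRegular G k lam (suc L)) where
  open Graph G
  open StronglyRegular srg
  open AmplyRegular amplyRegular
  open EdgeRegular edgeRegular

  common-count : ∀ a b → ∣ neighbours a ∩ neighbours b ∣ ≡ # (λ w → does (adj? a w) ∧ does (adj? b w))
  common-count a b = trans (cong ∣_∣ (∩-tabulate (does ∘ adj? a) (does ∘ adj? b))) (size-tabulate (λ w → does (adj? a w) ∧ does (adj? b w)))

  distance-2 : ∀ {a b u} → a ≢ b → ¬ Adj a b → Adj a u → Adj b u → Distance a b 2
  distance-2 {a} {b} a≢b ¬ab au bu = au ∷ (adj-sym bu ∷ []) , shortest
    where
    shortest : ∀ n → Walk a b n → 2 ≤ n
    shortest zero          []        = contradiction refl a≢b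
    shortest (suc zero)    (ab ∷ []) = contradiction ab ¬ab
    shortest (suc (suc n)) _         = s≤s (s≤s z≤n)

  countedGraph : CountedGraph v k lam L
  countedGraph = record
    { adj         = λ a b → does (adj? a b)
    ; adj-sym     = λ a b → does-⇔ (mk⇔ adj-sym adj-sym) (adj? a b) (adj? b a)
    ; adj-irrefl  = λ a → dec-false (adj? a a) (adj-irrefl a)
    ; degree      = λ a → trans (sym (size-tabulate (does ∘ adj? a))) (valency a)
    ; common-near = λ a b ab → trans (sym (common-count a b)) (common-adjacent a b (does-true (adj? a b) ab))
    ; common-far  = λ a b u a≁b au bu → trans (sym (common-count a b)) (common-distance2 a b (distance-2
        (does-false (a ≟ b) (∨-conicalˡ _ _ a≁b))
        (does-false (adj? a b) (∨-conicalʳ (does (a ≟ b)) _ a≁b))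
        (does-true (adj? a u) au) (does-true (adj? b u) bu)))
    }

-- Matching the equations puts numerals into the type of `Γ`, on which the arithmetic of the module
-- `m≡4` relies.
lines-m≡4 : ∀ {v k ℓ L} → k ≡ 2046 → ℓ ≡ 569 → L ≡ 81 → (Γ : CountedGraph v k ℓ L) → ∀ x →
  Local.Coclique Γ x 5 → ¬ Local.Coclique Γ x 6 → Lines Γ 5 6 x
lines-m≡4 refl refl refl Γ x = m≡4.lines Γ x

lines-of : ∀ s {v k ℓ L} → L ≡ L-poly s → 2 * ℓ ≡ 2ℓ-poly s → 2 * k ≡ 2k-poly s →
  (Γ : CountedGraph v k ℓ L) → ∀ x n → n < 5 + s →
  Local.Coclique Γ x (suc n) → ¬ Local.Coclique Γ x (suc (suc n)) → Lines Γ (5 + s) 6 x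
lines-of s {k = k} {ℓ} {L} eL eℓ ek Γ x n n<N Y maximum with m≤n⇒m<n∨m≡n (≤-pred n<N)
... | inj₁ n<4+s = generic-lines Γ x n n<N (≤-<-trans
  (+-monoʳ-≤ L (+-mono-≤ (*-monoˡ-≤ L (≤-pred n<4+s)) (*-monoˡ-≤ L (≤-pred n<4+s))))
  (Numbers.star s {k} eL eℓ ek)) Y maximum
lines-of (suc r) {k = k} eL eℓ ek Γ x _ n<N Y maximum | inj₂ refl = generic-lines Γ x (5 + r) n<N (star⁺ {r} {k} eL eℓ ek) Y maximum
lines-of zero eL eℓ ek Γ x _ n<N Y maximum | inj₂ refl =
  lines-m≡4 (*-cancelˡ-≡ _ 2046 2 ek) (*-cancelˡ-≡ _ 569 2 eℓ) eL Γ x Y maximum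

theorem4p3 : ∀ (m : ℕ) → 4 ≤ m →
    ∀ (v k lam μ : ℕ) → Parameters m v k lam μ →
    ∀ (G : Graph v) → ¬ StronglyRegular G k lam μ
theorem4p3 m 4≤m v k lam μ par G srg with m≤n⇒∃[o]m+o≡n 4≤m
... | s , refl = from-polynomials (μ≡ par) (2λ≡ par) (2k≡ par) par srg
  where
  from-polynomials : μ ≡ suc (L-poly s) → 2 * lam ≡ 2ℓ-poly s → 2 * k ≡ 2k-poly s →
    Parameters (4 + s) v k lam μ → StronglyRegular G k lam μ → ⊥
  from-polynomials refl eℓ ek par srg = by-order v par (countedGraph G srg)
    where
    module N = Numbers s {k} {lam} refl eℓ ek
    -- The argument starts from some vertex, so the order is split into zero and successor; `zero`
    -- is then a vertex.
    by-order : ∀ v → Parameters (4 + s) v k lam (suc (L-poly s)) → CountedGraph v k lam (L-poly s) → ⊥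
    by-order zero    par Γ = order-positive N.ℓ<k (Parameters.v-formula par)
    by-order (suc _) par Γ = contradiction-from-lines Γ zero N.ℓ<k N.claw N.few-pairs (lines-of s refl eℓ ek Γ)
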